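{- Let $\mathcal{K}$ and $\mathcal{K}'$ be sets of points in $\mathrm{PG}(5,3)$ such that $\#\mathcal{K}=\#\mathcal{K}'=12$ and such that $\#(\mathcal{H}\cap\mathcal{K})\in\{0,3,6\}$ and $\#(\mathcal{H}\cap\mathcal{K}')\in\{0,3,6\}$ for all hyperplanes $\mathcal{H}$ of $\mathrm{PG}(5,3)$. Choose five distinct points $P_0,\ldots,P_4$ in $\mathcal{K}$ and five distinct points $P_0',\ldots,P_4'$ in $\mathcal{K}'$. Then there is a unique collineation $\kappa$ of $\mathrm{PG}(5,3)$ with $\mathcal{K}^\kappa=\mathcal{K}'$ and $P_i^\kappa=P_i'$ for $i=0,\ldots,4$.
   Context: $\mathrm{PG}(5,3)$ is the $5$-dimensional projective space over $\mathrm{GF}(3)$, whose points are the one-dimensional subspaces and whose hyperplanes are the $5$-dimensional subspaces of a $6$-dimensional vector space over $\mathrm{GF}(3)$. A collineation is a bijection of the point set that maps lines onto lines. Images under maps are written as exponents. -}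

module Defs where

open import Data.Fin.Base using (Fin; toℕ)
open import Data.Fin.Patterns using (0F)
import Data.Nat.Base as ℕ
open import Data.Nat.DivMod using (_mod_)
open import Data.Product.Base using (Σ; ∃; ∃-syntax; _×_; _,_; proj₁)
open import Data.Vec.Base using (Vec; map; zipWith; replicate; foldr′)
open import Data.Vec.Relation.Unary.All using (All)
open import Function.Base using (_∘_)
open import Function.Bundles using (Bijection)
open import Level using (0ℓ; suc)
open import Relation.Binary.Bundles using (Setoid)
open import Relation.Binary.Definitions using (_Respects_)
import Relation.Binary.Construct.On as On
open import Relation.Binary.PropositionalEquality using (_≡_; setoid)
open import Relation.Unary using (Pred; _∈_; _⊆_; _∩_; _≐_)
open import Relation.Unary.Relation.Binary.Equality using (≐-setoid)

infixl 6 _+₃_ _+ᵥ_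
infixl 7 _*₃_ _·ᵥ_ _⊓_
infixl 8 _^_
infix  4 _≈ᶜ_ _HasSize_

GF3 : Set
GF3 = Fin 3

_+₃_ _*₃_ : GF3 → GF3 → GF3
a +₃ b = (toℕ a ℕ.+ toℕ b) mod 3
a *₃ b = (toℕ a ℕ.* toℕ b) mod 3

V : Set
V = Vec GF3 6

0ᵥ : V
0ᵥ = replicate 6 0F

_+ᵥ_ : V → V → V
_+ᵥ_ = zipWith _+₃_

_·ᵥ_ : GF3 → V → V
a ·ᵥ v = map (a *₃_) v

linComb : ∀ {d} → Vec GF3 d → Vec V d → V
linComb c b = foldr′ _+ᵥ_ 0ᵥ (zipWith _·ᵥ_ c b)

record Subspace : Set₁ where
  field
    vectors  : Pred V 0ℓ
    0-closed : 0ᵥ ∈ vectors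
    +-closed : ∀ {u v} → u ∈ vectors → v ∈ vectors → u +ᵥ v ∈ vectors
    ·-closed : ∀ a {v} → v ∈ vectors → a ·ᵥ v ∈ vectors

open Subspace public using (vectors)

LinearlyIndependent : ∀ {d} → Vec V d → Set
LinearlyIndependent {d} b = ∀ c → linComb c b ≡ 0ᵥ → c ≡ replicate d 0F

record IsBasis (U : Subspace) {d : ℕ.ℕ} (b : Vec V d) : Set where
  field
    inside      : All (vectors U) b
    independent : LinearlyIndependent b
    spanning    : ∀ {v} → v ∈ vectors U → ∃[ c ] linComb c b ≡ v

SubspaceOfDim : ℕ.ℕ → Set₁
SubspaceOfDim d = Σ Subspace λ U → ∃ λ (b : Vec V d) → IsBasis U b

vectorsOf : ∀ {d} → SubspaceOfDim d → Pred V 0ℓ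
vectorsOf = vectors ∘ proj₁

Point Line Hyperplane : Set₁
Point      = SubspaceOfDim 1
Line       = SubspaceOfDim 2
Hyperplane = SubspaceOfDim 5

-- Subspaces are equal when they contain the same vectors; the chosen basis
-- is ignored.
Points : Setoid (suc 0ℓ) 0ℓ
Points = On.setoid (≐-setoid V 0ℓ) (vectorsOf {1})

open Setoid Points public using (_≈_)

record PointSet : Set₂ where
  field
    points   : Pred Point 0ℓ
    respects : points Respects _≈_

open PointSet public using (points)

pointsOf : ∀ {d} → SubspaceOfDim d → PointSet
pointsOf U = record
  { points   = λ P → vectorsOf P ⊆ vectorsOf U
  ; respects = λ (_ , Q⊆P) P⊆U v∈Q → P⊆U (Q⊆P v∈Q)
  }

_⊓_ : PointSet → PointSet → PointSet
S ⊓ T = record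
  { points   = points S ∩ points T
  ; respects = λ P≈Q (P∈S , P∈T) →
      PointSet.respects S P≈Q P∈S , PointSet.respects T P≈Q P∈T
  }

members : PointSet → Setoid (suc 0ℓ) 0ℓ
members S = On.setoid Points (proj₁ {B = points S})

_HasSize_ : PointSet → ℕ.ℕ → Set₁
S HasSize n = Bijection (setoid (Fin n)) (members S)

image : ∀ {ℓ} → Bijection Points Points → Pred Point ℓ → Pred Point _
image f S Q = ∃[ P ] P ∈ S × Bijection.to f P ≈ Q

record Collineation : Set₁ where
  field
    bijection      : Bijection Points Points
    linesOntoLines : (L : Line) →
      ∃ λ (L′ : Line) →
        image bijection (points (pointsOf L)) ≐ points (pointsOf L′)

_^_ : Point → Collineation → Point
P ^ κ = Bijection.to (Collineation.bijection κ) P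

_^ˢ_ : ∀ {ℓ} → Pred Point ℓ → Collineation → Pred Point _
S ^ˢ κ = image (Collineation.bijection κ) S

_≈ᶜ_ : Collineation → Collineation → Set₁
κ ≈ᶜ λ′ = ∀ P → P ^ κ ≈ P ^ λ′

{-# OPTIONS --safe #-}

-- Any five points of K are independent: otherwise two of the hyperplanes through
-- five dependent points would have a combination meeting K in seven points. So
-- P₀, …, P₄ span a hyperplane containing exactly one further point of K, which
-- can be made their sum by rescaling; together these points are a frame of the
-- hyperplane. Independence of five points restricts the differences of the six
-- affine points of K off this hyperplane, and a finite search shows that they
-- are unique up to sign and translation. Hence K and P₀, …, P₄ have the same
-- coordinates in a suitable basis for every K, and matching two such bases gives κ.
-- Over GF(3) a collineation fixing two points of a line and a third one also
-- fixes the fourth. So a collineation fixing the frame fixes the hyperplane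
-- pointwise; it preserves the directions of the joins of affine points of K, hence
-- fixes these, and then it fixes every point.
module Submission where

open import Defs
open import Data.Bool.Base using (Bool; true; false; if_then_else_)
open import Data.Empty using (⊥; ⊥-elim)
open import Data.Fin.Base as Fin using (Fin; zero; suc; punchIn; punchOut; splitAt; _↑ˡ_; _↑ʳ_; funToFin; finToFun)
open import Data.Fin.Patterns
open import Data.Fin.Properties as Fin using (all?; any?; _≟_)
open import Data.List.Base using (List; _∷_; []; filter; concatMap)
open import Data.List.Membership.Propositional using (lose) renaming (_∈_ to _∈ˡ_)
open import Data.List.Membership.Propositional.Properties using (∈-filter⁺; ∈-concatMap⁺)
open import Data.List.Relation.Unary.All as ListAll using () renaming (All to AllList)
open import Data.List.Relation.Unary.Any using (here; there)
open import Data.Nat.Base as ℕ using (ℕ; zero; suc; z≤n; s≤s)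
import Data.Nat.Properties as ℕ
open import Data.Product using (∃-syntax; ∃!; _×_; _,_; proj₁; proj₂)
open import Data.Sum.Base using (_⊎_; inj₁; inj₂; [_,_]′)
open import Data.Vec.Base using (Vec; []; _∷_; map; zipWith; replicate; foldr′; lookup; tabulate; _++_; head; tail)
import Data.Vec.Properties as Vec
open import Data.Vec.Relation.Unary.All using (All; []; _∷_)
import Data.Vec.Relation.Unary.All.Properties as All
open import Function.Base using (_∘_; id; _$_)
open import Function.Bundles using (Bijection)
open import Function.Definitions using (Injective)
open import Relation.Binary.Bundles using (Setoid)
open import Relation.Binary.PropositionalEquality
  using (_≡_; _≢_; refl; sym; trans; cong; cong₂; subst; module ≡-Reasoning)
open import Relation.Nullary using (¬_; Dec; does; yes; no; contradiction)
open import Relation.Nullary.Decidable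
  using (toWitness; _×-dec_; _⊎-dec_; _→-dec_; ¬?; decidable-stable; dec-true; dec-false)
open import Relation.Unary using (_∈_; _≐_)

-- The dependencies among representatives of the twelve points form a linear code, and independence
-- of any five points says that its nonzero words have weight at least 6; it is the extended ternary
-- Golay code. Every restriction on coordinates comes from a word of weight at most 5 that would
-- otherwise exist. The sixth point of the hyperplane makes such words plentiful: a vector of the
-- hyperplane has three expressions in the frame, one for each multiple of the relation between the
-- six points, and all three must be heavy. This keeps the finite search small. For uniqueness the
-- obstacle is that a collineation is not known to come from a linear map and determines vectors
-- only up to sign. In coordinates it is therefore an arbitrary map on vectors that sends
-- combinations to combinations with unknown scalars, and being fixed means being proportional to
-- the image. Such a map still pulls subspaces back to subspaces. That controls the zeros and the
-- equal entries of the images, which is enough for vectors with entries 0 and 1; the other vectors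
-- of the hyperplane are fourth points of lines.

private
  variable
    d m n : ℕ

-- Vectors over GF(3) and linear maps

Vect : ℕ → Set
Vect n = Vec GF3 n

infixl 6 _⊕_
infixl 7 _⊙_
infix 4 _∝_ _∝?_ _≟ᵥ_

𝟎 : Vect n
𝟎 = replicate _ 0F

_⊕_ : Vect n → Vect n → Vect n
_⊕_ = zipWith _+₃_

_⊙_ : GF3 → Vect n → Vect n
a ⊙ v = map (a *₃_) v

-- For vectors of length six this agrees definitionally with `linComb`, so its lemmas apply there
-- unchanged; other lengths occur for coordinate vectors.
comb : Vect d → Vec (Vect n) d → Vect n
comb c b = foldr′ _⊕_ 𝟎 (zipWith _⊙_ c b)

unit : Fin n → Vect n
unit zero    = 1F ∷ 𝟎
unit (suc i) = 0F ∷ unit i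

_≟ᵥ_ : (u v : Vect n) → Dec (u ≡ v)
_≟ᵥ_ = Vec.≡-dec _≟_

-- The scalar may be zero: `𝟎` is proportional to every vector, and the relation is symmetric only
-- away from `𝟎`.
_∝_ : Vect n → Vect n → Set
u ∝ v = ∃[ a ] a ⊙ v ≡ u

_∝?_ : (u v : Vect n) → Dec (u ∝ v)
u ∝? v = any? λ a → a ⊙ v ≟ᵥ u

+-assoc : ∀ a b c → (a +₃ b) +₃ c ≡ a +₃ (b +₃ c)
+-assoc = toWitness {a? = all? λ a → all? λ b → all? λ c → (a +₃ b) +₃ c ≟ a +₃ (b +₃ c)} _

+-comm : ∀ a b → a +₃ b ≡ b +₃ a
+-comm = toWitness {a? = all? λ a → all? λ b → a +₃ b ≟ b +₃ a} _

+-identityˡ : ∀ a → 0F +₃ a ≡ a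
+-identityˡ = toWitness {a? = all? λ a → 0F +₃ a ≟ a} _

*-assoc : ∀ a b c → (a *₃ b) *₃ c ≡ a *₃ (b *₃ c)
*-assoc = toWitness {a? = all? λ a → all? λ b → all? λ c → (a *₃ b) *₃ c ≟ a *₃ (b *₃ c)} _

*-comm : ∀ a b → a *₃ b ≡ b *₃ a
*-comm = toWitness {a? = all? λ a → all? λ b → a *₃ b ≟ b *₃ a} _

*-identityˡ : ∀ a → 1F *₃ a ≡ a
*-identityˡ = toWitness {a? = all? λ a → 1F *₃ a ≟ a} _

*-distribˡ : ∀ a b c → a *₃ (b +₃ c) ≡ a *₃ b +₃ a *₃ c
*-distribˡ = toWitness {a? = all? λ a → all? λ b → all? λ c → a *₃ (b +₃ c) ≟ a *₃ b +₃ a *₃ c} _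

*-distribʳ : ∀ a b c → (a +₃ b) *₃ c ≡ a *₃ c +₃ b *₃ c
*-distribʳ = toWitness {a? = all? λ a → all? λ b → all? λ c → (a +₃ b) *₃ c ≟ a *₃ c +₃ b *₃ c} _

-- Nonzero scalars are their own inverses, so multiplication by `a` takes the place of division by
-- `a` throughout.
square≡1 : ∀ a → a ≢ 0F → a *₃ a ≡ 1F
square≡1 0F a≢0 = contradiction refl a≢0
square≡1 1F _   = refl
square≡1 2F _   = refl

⊕-assoc : (u v w : Vect n) → (u ⊕ v) ⊕ w ≡ u ⊕ (v ⊕ w)
⊕-assoc = Vec.zipWith-assoc +-assoc

⊕-comm : (u v : Vect n) → u ⊕ v ≡ v ⊕ u
⊕-comm = Vec.zipWith-comm +-comm

⊕-identityˡ : (v : Vect n) → 𝟎 ⊕ v ≡ v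
⊕-identityˡ = Vec.zipWith-identityˡ +-identityˡ

⊕-identityʳ : (v : Vect n) → v ⊕ 𝟎 ≡ v
⊕-identityʳ v = trans (⊕-comm v 𝟎) (⊕-identityˡ v)

⊙-distribˡ : ∀ a (u v : Vect n) → a ⊙ (u ⊕ v) ≡ a ⊙ u ⊕ a ⊙ v
⊙-distribˡ a []      []      = refl
⊙-distribˡ a (x ∷ u) (y ∷ v) = cong₂ _∷_ (*-distribˡ a x y) (⊙-distribˡ a u v)

⊙-distribʳ : ∀ a b (v : Vect n) → (a +₃ b) ⊙ v ≡ a ⊙ v ⊕ b ⊙ v
⊙-distribʳ a b []      = refl
⊙-distribʳ a b (x ∷ v) = cong₂ _∷_ (*-distribʳ a b x) (⊙-distribʳ a b v)

⊙-assoc : ∀ a b (v : Vect n) → (a *₃ b) ⊙ v ≡ a ⊙ (b ⊙ v)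
⊙-assoc a b []      = refl
⊙-assoc a b (x ∷ v) = cong₂ _∷_ (*-assoc a b x) (⊙-assoc a b v)

1⊙ : (v : Vect n) → 1F ⊙ v ≡ v
1⊙ []      = refl
1⊙ (x ∷ v) = cong₂ _∷_ (*-identityˡ x) (1⊙ v)

0⊙ : (v : Vect n) → 0F ⊙ v ≡ 𝟎
0⊙ []      = refl
0⊙ (x ∷ v) = cong (0F ∷_) (0⊙ v)

⊙𝟎 : ∀ a → a ⊙ 𝟎 {n} ≡ 𝟎
⊙𝟎 {n} a = trans (cong (a ⊙_) (sym (0⊙ 𝟎)))
  (trans (sym (⊙-assoc a 0F 𝟎)) (trans (cong (_⊙ 𝟎) (*-comm a 0F)) (0⊙ 𝟎)))

⊙-inverse : ∀ {a} → a ≢ 0F → (v : Vect n) → a ⊙ (a ⊙ v) ≡ v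
⊙-inverse {a = a} a≢0 v =
  trans (sym (⊙-assoc a a v)) (trans (cong (_⊙ v) (square≡1 a a≢0)) (1⊙ v))

⊕-interchange : (u v w z : Vect n) → (u ⊕ v) ⊕ (w ⊕ z) ≡ (u ⊕ w) ⊕ (v ⊕ z)
⊕-interchange u v w z = begin
  (u ⊕ v) ⊕ (w ⊕ z)  ≡⟨ ⊕-assoc u v (w ⊕ z) ⟩
  u ⊕ (v ⊕ (w ⊕ z))  ≡⟨ cong (u ⊕_) (⊕-assoc v w z) ⟨
  u ⊕ ((v ⊕ w) ⊕ z)  ≡⟨ cong (λ x → u ⊕ (x ⊕ z)) (⊕-comm v w) ⟩
  u ⊕ ((w ⊕ v) ⊕ z)  ≡⟨ cong (u ⊕_) (⊕-assoc w v z) ⟩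
  u ⊕ (w ⊕ (v ⊕ z))  ≡⟨ ⊕-assoc u w (v ⊕ z) ⟨
  (u ⊕ w) ⊕ (v ⊕ z)  ∎
  where open ≡-Reasoning

comb-⊕ : ∀ c c′ (b : Vec (Vect n) d) → comb (c ⊕ c′) b ≡ comb c b ⊕ comb c′ b
comb-⊕ []      []        []      = sym (⊕-identityˡ 𝟎)
comb-⊕ (x ∷ c) (x′ ∷ c′) (v ∷ b) =
  trans (cong₂ _⊕_ (⊙-distribʳ x x′ v) (comb-⊕ c c′ b))
        (⊕-interchange (x ⊙ v) (x′ ⊙ v) (comb c b) (comb c′ b))

comb-⊙ : ∀ a c (b : Vec (Vect n) d) → comb (a ⊙ c) b ≡ a ⊙ comb c b
comb-⊙ a []      []      = sym (⊙𝟎 a)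
comb-⊙ a (x ∷ c) (v ∷ b) =
  trans (cong₂ _⊕_ (⊙-assoc a x v) (comb-⊙ a c b)) (sym (⊙-distribˡ a (x ⊙ v) (comb c b)))

comb-𝟎 : (b : Vec (Vect n) d) → comb 𝟎 b ≡ 𝟎
comb-𝟎 []      = refl
comb-𝟎 (v ∷ b) = trans (cong₂ _⊕_ (0⊙ v) (comb-𝟎 b)) (⊕-identityˡ 𝟎)

comb-unit : ∀ i (b : Vec (Vect n) d) → comb (unit i) b ≡ lookup b i
comb-unit zero    (v ∷ b) = trans (cong₂ _⊕_ (1⊙ v) (comb-𝟎 b)) (⊕-identityʳ v)
comb-unit (suc i) (v ∷ b) =
  trans (cong₂ _⊕_ (0⊙ v) (comb-unit i b)) (⊕-identityˡ (lookup b i))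

comb-++ : ∀ {d e} c (b : Vec (Vect n) d) c′ (b′ : Vec (Vect n) e) →
          comb (c ++ c′) (b ++ b′) ≡ comb c b ⊕ comb c′ b′
comb-++ []      []      c′ b′ = sym (⊕-identityˡ (comb c′ b′))
comb-++ (x ∷ c) (v ∷ b) c′ b′ =
  trans (cong (x ⊙ v ⊕_) (comb-++ c b c′ b′)) (sym (⊕-assoc (x ⊙ v) (comb c b) (comb c′ b′)))

-- Linear identities with constant coefficients are decided by comparing coefficients.
data Expr (m : ℕ) : Set where
  var  : Fin m → Expr m
  _:+_ : Expr m → Expr m → Expr m
  _:·_ : GF3 → Expr m → Expr m

infixl 6 _:+_
infixl 7 _:·_

⟦_⟧ : Expr m → Vec (Vect n) m → Vect n
⟦ var i  ⟧ ρ = lookup ρ i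
⟦ e :+ f ⟧ ρ = ⟦ e ⟧ ρ ⊕ ⟦ f ⟧ ρ
⟦ a :· e ⟧ ρ = a ⊙ ⟦ e ⟧ ρ

coefficients : Expr m → Vect m
coefficients (var i)  = unit i
coefficients (e :+ f) = coefficients e ⊕ coefficients f
coefficients (a :· e) = a ⊙ coefficients e

⟦⟧-comb : (e : Expr m) (ρ : Vec (Vect n) m) → comb (coefficients e) ρ ≡ ⟦ e ⟧ ρ
⟦⟧-comb (var i)  ρ = comb-unit i ρ
⟦⟧-comb (e :+ f) ρ = trans (comb-⊕ (coefficients e) (coefficients f) ρ)
                           (cong₂ _⊕_ (⟦⟧-comb e ρ) (⟦⟧-comb f ρ))
⟦⟧-comb (a :· e) ρ = trans (comb-⊙ a (coefficients e) ρ) (cong (a ⊙_) (⟦⟧-comb e ρ))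

solve : (ρ : Vec (Vect n) m) (e f : Expr m) → coefficients e ≡ coefficients f → ⟦ e ⟧ ρ ≡ ⟦ f ⟧ ρ
solve ρ e f eq = trans (sym (⟦⟧-comb e ρ)) (trans (cong (λ c → comb c ρ) eq) (⟦⟧-comb f ρ))

record Linear (f : Vect m → Vect n) : Set where
  field
    +-homo : ∀ u v → f (u ⊕ v) ≡ f u ⊕ f v
    ·-homo : ∀ a v → f (a ⊙ v) ≡ a ⊙ f v

  0-homo : f 𝟎 ≡ 𝟎
  0-homo = trans (cong f (sym (0⊙ 𝟎))) (trans (·-homo 0F 𝟎) (0⊙ (f 𝟎)))

  comb-homo : ∀ {d} c (b : Vec (Vect m) d) → f (comb c b) ≡ comb c (map f b)
  comb-homo []      []      = 0-homo
  comb-homo (x ∷ c) (v ∷ b) =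
    trans (+-homo (x ⊙ v) (comb c b)) (cong₂ _⊕_ (·-homo x v) (comb-homo c b))

open Linear

comb-linear : (b : Vec (Vect n) d) → Linear (λ c → comb c b)
comb-linear b = record { +-homo = λ c c′ → comb-⊕ c c′ b ; ·-homo = λ a c → comb-⊙ a c b }

units : ∀ n → Vec (Vect n) n
units zero    = []
units (suc n) = unit 0F ∷ map (0F ∷_) (units n)

comb-units : (c : Vect n) → comb c (units n) ≡ c
comb-units []      = refl
comb-units {suc n} (x ∷ c) = trans
  (cong (x ⊙ unit 0F ⊕_)
    (trans (sym (comb-homo 0∷-linear c (units n))) (cong (0F ∷_) (comb-units c))))
  (cong₂ _∷_
    (trans (+-comm (x *₃ 1F) 0F)
           (trans (+-identityˡ (x *₃ 1F)) (trans (*-comm x 1F) (*-identityˡ x))))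
    (trans (cong (_⊕ c) (⊙𝟎 x)) (⊕-identityˡ c)))
  where
  0∷-linear : Linear (0F ∷_)
  0∷-linear = record
    { +-homo = λ _ _ → refl
    ; ·-homo = λ a v → cong (_∷ a ⊙ v) (*-comm 0F a)
    }

lookup-extensionality : ∀ {A : Set} {u v : Vec A n} → (∀ i → lookup u i ≡ lookup v i) → u ≡ v
lookup-extensionality {u = u} {v} eq =
  trans (sym (Vec.tabulate∘lookup u)) (trans (Vec.tabulate-cong eq) (Vec.tabulate∘lookup v))

lookup-⊕ : ∀ (u v : Vect n) i → lookup (u ⊕ v) i ≡ lookup u i +₃ lookup v i
lookup-⊕ u v i = Vec.lookup-zipWith _+₃_ i u v

lookup-⊙ : ∀ a (v : Vect n) i → lookup (a ⊙ v) i ≡ a *₃ lookup v i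
lookup-⊙ a v i = Vec.lookup-map i (a *₃_) v

lookup-𝟎 : (i : Fin n) → lookup 𝟎 i ≡ 0F
lookup-𝟎 i = Vec.lookup-replicate i 0F

≢𝟎⇒nonzero-entry : (v : Vect n) → v ≢ 𝟎 → ∃[ i ] lookup v i ≢ 0F
≢𝟎⇒nonzero-entry v v≢0 with any? (λ i → ¬? (lookup v i ≟ 0F))
... | yes nonzero = nonzero
... | no ¬nonzero = contradiction
  (lookup-extensionality λ i →
    trans (decidable-stable (lookup v i ≟ 0F) λ ne → ¬nonzero (i , ne)) (sym (lookup-𝟎 i)))
  v≢0

u⊖v≡𝟎⇒u≡v : (u v : Vect n) → u ⊕ 2F ⊙ v ≡ 𝟎 → u ≡ v
u⊖v≡𝟎⇒u≡v u v eq = trans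
  (sym (solve (u ∷ v ∷ []) (var 0F :+ 2F :· var 1F :+ var 1F) (var 0F) refl))
  (trans (cong (_⊕ v) eq) (⊕-identityˡ v))

-- There are 3 ^ n vectors and only 3 ^ m possible values, so two vectors share a
-- value, and their difference is in the kernel.
abstract
  nontrivial-kernel : {f : Vect n → Vect m} → Linear f → m ℕ.< n → ∃[ v ] v ≢ 𝟎 × f v ≡ 𝟎
  nontrivial-kernel {n} {m} {f} lin m<n
    with i , j , i<j , eq ← Fin.pigeonhole (ℕ.^-monoʳ-< 3 (s≤s (s≤s z≤n)) m<n)
                              (λ i → funToFin (lookup (f (tabulate (finToFun i))))) =
      u ⊕ 2F ⊙ v
    , (λ u⊖v≡𝟎 → Fin.<⇒≢ i<j (u≡v⇒i≡j (u⊖v≡𝟎⇒u≡v u v u⊖v≡𝟎)))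
    , (begin
        f (u ⊕ 2F ⊙ v)    ≡⟨ +-homo lin u (2F ⊙ v) ⟩
        f u ⊕ f (2F ⊙ v)  ≡⟨ cong₂ _⊕_ fu≡fv (·-homo lin 2F v) ⟩
        f v ⊕ 2F ⊙ f v    ≡⟨ solve (f v ∷ []) (var 0F :+ 2F :· var 0F) (0F :· var 0F) refl ⟩
        0F ⊙ f v          ≡⟨ 0⊙ (f v) ⟩
        𝟎                 ∎)
    where
    open ≡-Reasoning
    u v : Vect n
    u = tabulate (finToFun i)
    v = tabulate (finToFun j)

    funToFin-cong : ∀ {k} {g h : Fin k → Fin 3} → (∀ i → g i ≡ h i) → funToFin g ≡ funToFin h
    funToFin-cong {zero}  eq = refl
    funToFin-cong {suc k} eq = cong₂ Fin.combine (eq zero) (funToFin-cong (eq ∘ suc))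

    finToFun-injective : ∀ {k} {i j : Fin (3 ℕ.^ k)} → (∀ l → finToFun {3} {k} i l ≡ finToFun j l) → i ≡ j
    finToFun-injective {k} {i} {j} eq =
      trans (sym (Fin.funToFin-finToFin {k} {3} i))
            (trans (funToFin-cong eq) (Fin.funToFin-finToFin {k} {3} j))

    u≡v⇒i≡j : u ≡ v → i ≡ j
    u≡v⇒i≡j u≡v = finToFun-injective λ l →
      trans (sym (Vec.lookup∘tabulate (finToFun i) l))
            (trans (cong (λ w → lookup w l) u≡v) (Vec.lookup∘tabulate (finToFun j) l))

    fu≡fv : f u ≡ f v
    fu≡fv = lookup-extensionality λ l →
      trans (sym (Fin.finToFun-funToFin (lookup (f u)) l))
            (trans (cong (λ k → finToFun {3} {m} k l) eq) (Fin.finToFun-funToFin (lookup (f v)) l))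

-- Points, hyperplanes and linear functionals

dot : Vect n → Vect n → GF3
dot []      []      = 0F
dot (x ∷ u) (y ∷ v) = x *₃ y +₃ dot u v

+-interchange : ∀ a b c d → (a +₃ b) +₃ (c +₃ d) ≡ (a +₃ c) +₃ (b +₃ d)
+-interchange = toWitness
  {a? = all? λ a → all? λ b → all? λ c → all? λ d → (a +₃ b) +₃ (c +₃ d) ≟ (a +₃ c) +₃ (b +₃ d)} _

dot-comm : (u v : Vect n) → dot u v ≡ dot v u
dot-comm []      []      = refl
dot-comm (x ∷ u) (y ∷ v) = cong₂ _+₃_ (*-comm x y) (dot-comm u v)

dot-⊕ : (u v w : Vect n) → dot u (v ⊕ w) ≡ dot u v +₃ dot u w
dot-⊕ []      []      []      = refl
dot-⊕ (x ∷ u) (y ∷ v) (z ∷ w) =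
  trans (cong₂ _+₃_ (*-distribˡ x y z) (dot-⊕ u v w))
        (+-interchange (x *₃ y) (x *₃ z) (dot u v) (dot u w))

*-left-comm : ∀ a b c → a *₃ (b *₃ c) ≡ b *₃ (a *₃ c)
*-left-comm a b c =
  trans (sym (*-assoc a b c)) (trans (cong (_*₃ c) (*-comm a b)) (*-assoc b a c))

dot-⊙ : ∀ a (u v : Vect n) → dot u (a ⊙ v) ≡ a *₃ dot u v
dot-⊙ a []      []      = *-comm 0F a
dot-⊙ a (x ∷ u) (y ∷ v) =
  trans (cong₂ _+₃_ (*-left-comm x a y) (dot-⊙ a u v)) (sym (*-distribˡ a (x *₃ y) (dot u v)))

dot-𝟎 : (u : Vect n) → dot u 𝟎 ≡ 0F
dot-𝟎 []      = refl
dot-𝟎 (x ∷ u) = trans (cong₂ _+₃_ (*-comm x 0F) (dot-𝟎 u)) refl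

dot-comb : ∀ (u : Vect n) c (b : Vec (Vect n) d) → dot u (comb c b) ≡ dot c (map (dot u) b)
dot-comb u []      []      = dot-𝟎 u
dot-comb u (x ∷ c) (v ∷ b) =
  trans (dot-⊕ u (x ⊙ v) (comb c b)) (cong₂ _+₃_ (dot-⊙ x u v) (dot-comb u c b))

dot-single : ∀ (c e : Vect n) i → (∀ j → j ≢ i → lookup c j *₃ lookup e j ≡ 0F) →
             dot c e ≡ lookup c i *₃ lookup e i
dot-single {suc n} (x ∷ c) (y ∷ e) zero    off = trans (cong (x *₃ y +₃_) (dot-zero c e λ j → off (suc j) λ ()))
                                            (trans (+-comm (x *₃ y) 0F) (+-identityˡ (x *₃ y)))
  where
  dot-zero : ∀ {n} (c e : Vect n) → (∀ j → lookup c j *₃ lookup e j ≡ 0F) → dot c e ≡ 0F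
  dot-zero []      []      eq = refl
  dot-zero (x ∷ c) (y ∷ e) eq = cong₂ _+₃_ (eq zero) (dot-zero c e (eq ∘ suc))
dot-single {suc n} (x ∷ c) (y ∷ e) (suc i) off =
  trans (cong₂ _+₃_ (off zero λ ()) (dot-single c e i λ j j≢i → off (suc j) (j≢i ∘ Fin.suc-injective)))
        (+-identityˡ (lookup c i *₃ lookup e i))

-- Fewer linear conditions than unknowns: `u` is the equation of a hyperplane through all `w i`.
common-annihilator : m ℕ.< n → (w : Fin m → Vect n) → ∃[ u ] u ≢ 𝟎 × ∀ i → dot u (w i) ≡ 0F
common-annihilator {m} {n} m<n w =
  let u , u≢0 , eq = nontrivial-kernel evaluate-linear m<n in
  u , u≢0 , λ i → trans (dot-comm u (w i))
    (trans (sym (Vec.lookup∘tabulate (λ i → dot (w i) u) i))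
           (trans (cong (λ e → lookup e i) eq) (lookup-𝟎 i)))
  where
  evaluate : Vect n → Vect m
  evaluate u = tabulate λ i → dot (w i) u

  evaluate-linear : Linear evaluate
  evaluate-linear = record
    { +-homo = λ u v → lookup-extensionality λ i → trans (Vec.lookup∘tabulate _ i)
        (trans (dot-⊕ (w i) u v)
          (sym (trans (lookup-⊕ (evaluate u) (evaluate v) i)
                      (cong₂ _+₃_ (Vec.lookup∘tabulate _ i) (Vec.lookup∘tabulate _ i)))))
    ; ·-homo = λ a v → lookup-extensionality λ i → trans (Vec.lookup∘tabulate _ i)
        (trans (dot-⊙ a (w i) v)
          (sym (trans (lookup-⊙ a (evaluate v) i) (cong (a *₃_) (Vec.lookup∘tabulate _ i)))))
    }

-- The factor `2F *₃ a` is minus the inverse of `a`.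
solve-head : ∀ a x y → a ≢ 0F → a *₃ x +₃ y ≡ 0F → (2F *₃ a) *₃ y ≡ x
solve-head = toWitness
  {a? = all? λ a → all? λ x → all? λ y →
    ¬? (a ≟ 0F) →-dec (a *₃ x +₃ y ≟ 0F →-dec (2F *₃ a) *₃ y ≟ x)} _

-- Turns the equation of a hyperplane into a parametrization, from which a basis can be read off: at
-- the first nonzero entry of `u` the equation is solved for that coordinate, and all others remain
-- free.
kernel-parametrization : (u : Vect (suc n)) → u ≢ 𝟎 →
  ∃[ g ] Linear {n} g × (∀ c → g c ≡ 𝟎 → c ≡ 𝟎) × (∀ v → dot u v ≡ 0F → ∃[ c ] g c ≡ v)
kernel-parametrization {n} (a ∷ u) u≢0 with a ≟ 0F
... | no a≢0 =
    (λ c → (2F *₃ a) *₃ dot u c ∷ c)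
  , record
      { +-homo = λ c c′ → cong (_∷ c ⊕ c′)
          (trans (cong ((2F *₃ a) *₃_) (dot-⊕ u c c′)) (*-distribˡ (2F *₃ a) (dot u c) (dot u c′)))
      ; ·-homo = λ x c → cong (_∷ x ⊙ c)
          (trans (cong ((2F *₃ a) *₃_) (dot-⊙ x u c)) (*-left-comm (2F *₃ a) x (dot u c)))
      }
  , (λ c eq → cong tail eq)
  , (λ { (x ∷ v) eq → v , cong (_∷ v) (solve-head a x (dot u v) a≢0 eq) })
kernel-parametrization {zero} (.0F ∷ []) u≢0 | yes refl = contradiction refl u≢0
kernel-parametrization {suc n} (.0F ∷ u) u≢0 | yes refl
  with g , g-linear , g-injective , g-onto ← kernel-parametrization u (u≢0 ∘ cong (0F ∷_)) =
    (λ c → head c ∷ g (tail c))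
  , record
      { +-homo = λ { (x ∷ c) (x′ ∷ c′) → cong (x +₃ x′ ∷_) (+-homo g-linear c c′) }
      ; ·-homo = λ { a (x ∷ c) → cong (a *₃ x ∷_) (·-homo g-linear a c) }
      }
  , (λ { (x ∷ c) eq → cong₂ _∷_ (cong head eq) (g-injective c (cong tail eq)) })
  , (λ { (x ∷ v) eq →
         let c , gc≡v = g-onto v (trans (sym (+-identityˡ (dot u v))) eq) in
         x ∷ c , cong (x ∷_) gc≡v })

∝-refl : (v : Vect n) → v ∝ v
∝-refl v = 1F , 1⊙ v

∝-trans : {u v w : Vect n} → u ∝ v → v ∝ w → u ∝ w
∝-trans {w = w} (a , refl) (b , refl) = a *₃ b , ⊙-assoc a b w

∝-nonzero : {u v : Vect n} → u ≢ 𝟎 → (u∝v : u ∝ v) → proj₁ u∝v ≢ 0F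
∝-nonzero {v = v} u≢0 (a , refl) refl = u≢0 (0⊙ v)

∝-sym : {u v : Vect n} → u ≢ 𝟎 → u ∝ v → v ∝ u
∝-sym {v = v} u≢0 u∝v@(a , refl) = a , ⊙-inverse (∝-nonzero u≢0 u∝v) v

span : (b : Vec V d) → LinearlyIndependent b → SubspaceOfDim d
span {d} b independent = U , b , record
  { inside      = All.lookup⁻ λ i → unit i , comb-unit i b
  ; independent = independent
  ; spanning    = id
  }
  where
  U : Subspace
  U = record
    { vectors  = λ v → ∃[ c ] linComb c b ≡ v
    ; 0-closed = 𝟎 , comb-𝟎 b
    ; +-closed = λ { (c , refl) (c′ , refl) → c ⊕ c′ , comb-⊕ c c′ b }
    ; ·-closed = λ { a (c , refl) → a ⊙ c , comb-⊙ a c b }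
    }

generator : Point → V
generator (_ , (v ∷ []) , _) = v

linComb-singleton : ∀ a v → linComb (a ∷ []) (v ∷ []) ≡ a ⊙ v
linComb-singleton a v = ⊕-identityʳ (a ⊙ v)

generator≢𝟎 : ∀ P → generator P ≢ 𝟎
generator≢𝟎 (_ , (.𝟎 ∷ []) , isBasis) refl
  with () ← IsBasis.independent isBasis (1F ∷ []) (trans (linComb-singleton 1F 𝟎) (1⊙ 𝟎))

∈⇒∝ : ∀ P {v} → v ∈ vectorsOf P → v ∝ generator P
∈⇒∝ (_ , (g ∷ []) , isBasis) v∈P with (a ∷ []) , eq ← IsBasis.spanning isBasis v∈P =
  a , trans (sym (linComb-singleton a g)) eq

∝⇒⊆ : ∀ {d} P (U : SubspaceOfDim d) → generator P ∈ vectorsOf U → P ∈ points (pointsOf U)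
∝⇒⊆ P (U , _) g∈U v∈P with a , refl ← ∈⇒∝ P v∈P = Subspace.·-closed U a g∈U

generator∈ : ∀ P → generator P ∈ vectorsOf P
generator∈ (_ , (g ∷ []) , isBasis) with g∈P ∷ [] ← IsBasis.inside isBasis = g∈P

≈⇒∝ : ∀ P Q → P ≈ Q → generator P ∝ generator Q
≈⇒∝ P Q (P⊆Q , _) = ∈⇒∝ Q (P⊆Q (generator∈ P))

∝⇒≈ : ∀ P Q → generator P ∝ generator Q → P ≈ Q
∝⇒≈ P Q P∝Q = ⊆-from P Q P∝Q , ⊆-from Q P (∝-sym (generator≢𝟎 P) P∝Q)
  where
  ⊆-from : ∀ P Q → generator P ∝ generator Q → ∀ {v} → v ∈ vectorsOf P → v ∈ vectorsOf Q
  ⊆-from P Q@(U , _) (a , eq) =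
    ∝⇒⊆ P Q (subst (_∈ vectorsOf Q) eq (Subspace.·-closed U a (generator∈ Q)))

point : (v : V) → v ≢ 𝟎 → Point
point v v≢0 = span (v ∷ []) λ { (a ∷ []) eq → cong (_∷ []) (a≡0 a (trans (sym (linComb-singleton a v)) eq)) }
  where
  a≡0 : ∀ a → a ⊙ v ≡ 𝟎 → a ≡ 0F
  a≡0 a av≡0 with a ≟ 0F
  ... | yes eq  = eq
  ... | no  a≢0 = contradiction (trans (sym (⊙-inverse a≢0 v)) (trans (cong (a ⊙_) av≡0) (⊙𝟎 a))) v≢0

size-bound : (S : PointSet) → S HasSize n → (Q : Fin m → Point) → Injective _≡_ _≈_ Q →
             (∀ i → Q i ∈ points S) → m ℕ.≤ n
size-bound S size Q injective Q∈S = Fin.injective⇒≤ {f = index} λ {i} {j} eq →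
  injective (Setoid.trans Points {Q i} {enumerate (index i)} {Q j} (Setoid.sym Points {enumerate (index i)} {Q i} (index-≈ i))
    (subst (λ l → enumerate l ≈ Q j) (sym eq) (index-≈ j)))
  where
  enumerate = λ l → proj₁ (Bijection.to size l)
  index = λ i → proj₁ (Bijection.strictlySurjective size (Q i , Q∈S i))
  index-≈ : ∀ i → enumerate (index i) ≈ Q i
  index-≈ i = proj₂ (Bijection.strictlySurjective size (Q i , Q∈S i))

HasSections036 : PointSet → Set₁
HasSections036 K = (H : Hyperplane) → ∃[ n ] n ∈ˡ (0 ∷ 3 ∷ 6 ∷ []) × (pointsOf H ⊓ K) HasSize n

module _ (K : PointSet) (sections : HasSections036 K) where

  sections≤6 : (H : Hyperplane) → m ℕ.≤ proj₁ (sections H) → m ℕ.≤ 6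
  sections≤6 H m≤n with sections H
  ... | _ , here refl                 , _ = ℕ.≤-trans m≤n z≤n
  ... | _ , there (here refl)         , _ = ℕ.≤-trans m≤n (s≤s (s≤s (s≤s z≤n)))
  ... | _ , there (there (here refl)) , _ = m≤n

  no-seven : (H : Hyperplane) (Q : Fin 7 → Point) → Injective _≡_ _≈_ Q →
             (∀ i → Q i ∈ points K) → ¬ (∀ i → generator (Q i) ∈ vectorsOf H)
  no-seven H Q injective Q∈K Q∈H = ℕ.1+n≰n {6} $ sections≤6 H $
    size-bound (pointsOf H ⊓ K) (proj₂ (proj₂ (sections H))) Q injective
      λ i → (λ {v} → ∝⇒⊆ (Q i) H (Q∈H i)) , Q∈K i

-- The bound of six on hyperplane sections, in terms of equations: `k` lists representatives of the
-- twelve points and `u` is the equation of a hyperplane.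
FewZeros : (Fin 12 → V) → Set
FewZeros k = ∀ u → u ≢ 𝟎 → (t : Fin 7 → Fin 12) → Injective _≡_ _≡_ t →
             ¬ (∀ i → dot u (k (t i)) ≡ 0F)

few-zeros : (K : PointSet) → HasSections036 K →
  (Q : Fin 12 → Point) → Injective _≡_ _≈_ Q → (∀ i → Q i ∈ points K) →
  (k : Fin 12 → V) → (∀ i → generator (Q i) ∝ k i) → FewZeros k
few-zeros K sections Q injective Q∈K k Q∝k u u≢0 t t-injective zeros
  with g , g-linear , g-injective , g-onto ← kernel-parametrization u u≢0 =
  no-seven K sections (span (map g (units 5)) g-independent) (Q ∘ t) (t-injective ∘ injective)
    (Q∈K ∘ t) λ i → in-span (proj₁ (Q∝k (t i))) (zeros i) (proj₂ (Q∝k (t i)))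
  where
  linComb-units : ∀ c → linComb c (map g (units 5)) ≡ g c
  linComb-units c = trans (sym (comb-homo g-linear c (units 5))) (cong g (comb-units c))

  g-independent : LinearlyIndependent (map g (units 5))
  g-independent c eq = g-injective c (trans (sym (linComb-units c)) eq)

  in-span : ∀ a {v w} → dot u v ≡ 0F → a ⊙ v ≡ w → ∃[ c ] linComb c (map g (units 5)) ≡ w
  in-span a {v} dot≡0 refl =
    let c , eq = g-onto (a ⊙ v) (trans (dot-⊙ a u v) (trans (cong (a *₃_) dot≡0) (*-comm a 0F))) in
    c , trans (linComb-units c) eq

-- Any five points of K are independent

record Complement (f : Fin m → Fin (m ℕ.+ n)) : Set where
  field
    rest           : Fin n → Fin (m ℕ.+ n)
    rest-injective : Injective _≡_ _≡_ rest
    disjoint       : ∀ i j → f i ≢ rest j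
    covers         : ∀ x → (∃[ i ] f i ≡ x) ⊎ (∃[ j ] rest j ≡ x)

-- Recursion on `m`: the value `f 0F` is deleted from the codomain by `punchOut` and skipped again
-- by `punchIn`.
complement : (f : Fin m → Fin (m ℕ.+ n)) → Injective _≡_ _≡_ f → Complement {m} {n} f
complement {zero} f f-injective = record
  { rest = id ; rest-injective = id ; disjoint = λ () ; covers = λ x → inj₂ (x , refl) }
complement {suc m} {n} f f-injective = record
  { rest           = punchIn (f 0F) ∘ g
  ; rest-injective = λ {i} {j} eq → g-injective (Fin.punchIn-injective (f 0F) (g i) (g j) eq)
  ; disjoint       = disjoint
  ; covers         = covers
  }
  where
  f0≢ : ∀ i → f 0F ≢ f (suc i)
  f0≢ i eq with () ← f-injective eq

  f′ : Fin m → Fin (m ℕ.+ n)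
  f′ i = punchOut (f0≢ i)

  open Complement (complement {m} {n} f′ λ {i} {j} eq →
      Fin.suc-injective (f-injective (Fin.punchOut-injective (f0≢ i) (f0≢ j) eq)))
    renaming (rest to g; rest-injective to g-injective; disjoint to f′≢g; covers to f′g-covers)

  disjoint : ∀ i j → f i ≢ punchIn (f 0F) (g j)
  disjoint zero    j eq = Fin.punchInᵢ≢i (f 0F) (g j) (sym eq)
  disjoint (suc i) j eq = f′≢g i j
    (Fin.punchIn-injective (f 0F) (f′ i) (g j) (trans (Fin.punchIn-punchOut (f0≢ i)) eq))

  covers : ∀ x → (∃[ i ] f i ≡ x) ⊎ (∃[ j ] punchIn (f 0F) (g j) ≡ x)
  covers x with f 0F ≟ x
  ... | yes eq = inj₁ (0F , eq)
  ... | no f0≢x with f′g-covers (punchOut f0≢x)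
  ...   | inj₁ (i , eq) = inj₁ (suc i , Fin.punchOut-injective (f0≢ i) f0≢x eq)
  ...   | inj₂ (j , eq) = inj₂ (j , trans (cong (punchIn (f 0F)) eq) (Fin.punchIn-punchOut f0≢x))

append : ∀ {a} {A : Set a} → (Fin m → A) → (Fin n → A) → Fin (m ℕ.+ n) → A
append {m} f g i = [ f , g ]′ (splitAt m i)

append-all : ∀ {a p} {A : Set a} (P : A → Set p) {f : Fin m → A} {g : Fin n → A} →
             (∀ i → P (f i)) → (∀ j → P (g j)) → ∀ i → P (append f g i)
append-all {m} P Pf Pg i with splitAt m i
... | inj₁ j = Pf j
... | inj₂ j = Pg j

append-injective : ∀ {a ℓ} {A : Set a} (_∼_ : A → A → Set ℓ) → (∀ {x y} → x ∼ y → y ∼ x) →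
  {f : Fin m → A} {g : Fin n → A} → Injective _≡_ _∼_ f → Injective _≡_ _∼_ g →
  (∀ i j → ¬ (f i ∼ g j)) → Injective _≡_ _∼_ (append f g)
append-injective {m} {n} _∼_ ∼-sym f-injective g-injective disjoint {i} {j} eq
  with splitAt m i in p | splitAt m j in q
... | inj₁ i′ | inj₁ j′ = trans (sym (Fin.splitAt⁻¹-↑ˡ p))
                            (trans (cong (_↑ˡ n) (f-injective eq)) (Fin.splitAt⁻¹-↑ˡ q))
... | inj₁ i′ | inj₂ j′ = contradiction eq (disjoint i′ j′)
... | inj₂ i′ | inj₁ j′ = contradiction (∼-sym eq) (disjoint j′ i′)
... | inj₂ i′ | inj₂ j′ = trans (sym (Fin.splitAt⁻¹-↑ʳ p))
                            (trans (cong (m ↑ʳ_) (g-injective eq)) (Fin.splitAt⁻¹-↑ʳ q))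

weight : Vect n → ℕ
weight []          = 0
weight (0F ∷ v)    = weight v
weight (suc _ ∷ v) = suc (weight v)

-- The support is padded with positions of zeros to exactly `m` positions, so that a dependency
-- among fewer than five points is treated like one among five.
support-cover : (c : Vect n) → m ℕ.≤ n → weight c ℕ.≤ m →
  ∃[ t ] Injective {A = Fin m} _≡_ _≡_ t × (∀ j → lookup c j ≢ 0F → ∃[ i ] t i ≡ j)
support-cover [] z≤n _ = (λ ()) , (λ { {()} }) , λ ()
support-cover {suc n} {m} (0F ∷ c) m≤1+n wt≤m with m ℕ.≤? n
... | yes m≤n with t , t-injective , cover ← support-cover c m≤n wt≤m =
      suc ∘ t , t-injective ∘ Fin.suc-injective
    , λ { zero    ne → contradiction refl ne
        ; (suc j) ne → let i , eq = cover j ne in i , cong suc eq }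
-- Here `m` is `suc n`, so no position can be spared, not even one with entry zero.
... | no m≰n with refl ← ℕ.≤-antisym m≤1+n (ℕ.≰⇒> m≰n) = id , id , λ j _ → j , refl
support-cover {suc n} {suc m} (suc _ ∷ c) (s≤s m≤n) (s≤s wt≤m)
  with t , t-injective , cover ← support-cover c m≤n wt≤m =
      (λ { zero → zero ; (suc i) → suc (t i) })
    , (λ { {zero}  {zero}  _  → refl
         ; {suc i} {suc j} eq → cong suc (t-injective (Fin.suc-injective eq)) })
    , λ { zero    _  → zero , refl
        ; (suc j) ne → let i , eq = cover j ne in suc i , cong suc eq }

*-cancel-0 : ∀ a x → a ≢ 0F → a *₃ x ≡ 0F → x ≡ 0F
*-cancel-0 = toWitness
  {a? = all? λ a → all? λ x → ¬? (a ≟ 0F) →-dec (a *₃ x ≟ 0F →-dec x ≟ 0F)} _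

*-nonzero : ∀ a b → a ≢ 0F → b ≢ 0F → a *₃ b ≢ 0F
*-nonzero a b a≢0 b≢0 eq = b≢0 (*-cancel-0 a b a≢0 eq)

-- As `b` is its own inverse, `2F *₃ (a *₃ b)` is minus the quotient of `a` by `b`.
eliminate : ∀ a b → b ≢ 0F → a +₃ (2F *₃ (a *₃ b)) *₃ b ≡ 0F
eliminate = toWitness
  {a? = all? λ a → all? λ b → ¬? (b ≟ 0F) →-dec a +₃ (2F *₃ (a *₃ b)) *₃ b ≟ 0F} _

-- Pigeonhole on the two nonzero elements.
three-nonzero : ∀ (a b c : GF3) → a ≢ 0F → b ≢ 0F → c ≢ 0F → a ≡ b ⊎ a ≡ c ⊎ b ≡ c
three-nonzero = toWitness
  {a? = all? λ a → all? λ b → all? λ c →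
    ¬? (a ≟ 0F) →-dec (¬? (b ≟ 0F) →-dec (¬? (c ≟ 0F) →-dec (a ≟ b ⊎-dec (a ≟ c ⊎-dec b ≟ c))))} _

-- The dependencies of `k` are viewed as the words of a code.
MinimumDistance6 : Vec V n → Set
MinimumDistance6 k = ∀ c → linComb c k ≡ 0ᵥ → weight c ℕ.≤ 5 → c ≡ 𝟎

module _ (k : Vec V 12) (few : FewZeros (lookup k)) (c : Vect 12) (dependency : linComb c k ≡ 0ᵥ)
         (t : Fin 5 → Fin 12) (t-injective : Injective _≡_ _≡_ t)
         (t-covers : ∀ j → lookup c j ≢ 0F → ∃[ i ] t i ≡ j)
         (i : Fin 5) (cᵢ≢0 : lookup c (t i) ≢ 0F)
         (r : Fin 7 → Fin 12) (r-injective : Injective _≡_ _≡_ r) (t≢r : ∀ i j → t i ≢ r j)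
  where

  value : V → Fin 12 → GF3
  value u j = dot u (lookup k j)

  VanishesOnT : V → Set
  VanishesOnT u = ∀ i → value u (t i) ≡ 0F

  -- Applying `u` to the dependency leaves only the term at `t i`, whose coefficient is nonzero:
  -- every other term has coefficient zero or belongs to a point where `u` vanishes.
  fifth : ∀ u → (∀ l → l ≢ i → value u (t l) ≡ 0F) → VanishesOnT u
  fifth u vanish l with l ≟ i
  ... | no  l≢i  = vanish l l≢i
  ... | yes refl = *-cancel-0 (lookup c (t i)) (value u (t i)) cᵢ≢0 (begin
    lookup c (t i) *₃ value u (t i)
      ≡⟨ cong (lookup c (t i) *₃_) (Vec.lookup-map (t i) (dot u) k) ⟨
    lookup c (t i) *₃ lookup (map (dot u) k) (t i)
      ≡⟨ dot-single c (map (dot u) k) (t i) off ⟨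
    dot c (map (dot u) k)
      ≡⟨ dot-comb u c k ⟨
    dot u (linComb c k)
      ≡⟨ cong (dot u) dependency ⟩
    dot u 𝟎
      ≡⟨ dot-𝟎 u ⟩
    0F ∎)
    where
    open ≡-Reasoning
    off : ∀ j → j ≢ t i → lookup c j *₃ lookup (map (dot u) k) j ≡ 0F
    off j j≢tᵢ with lookup c j ≟ 0F
    ... | yes cⱼ≡0 = cong (_*₃ lookup (map (dot u) k) j) cⱼ≡0
    ... | no  cⱼ≢0 with l , refl ← t-covers j cⱼ≢0 =
      trans (cong (lookup c j *₃_) (trans (Vec.lookup-map j (dot u) k) (vanish l λ { refl → j≢tᵢ refl })))
            (*-comm (lookup c j) 0F)

  -- Five conditions on six coordinates: `r x` is put in the place of `t i`, at which `u` vanishes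
  -- by `fifth`.
  through : ∀ x → ∃[ u ] u ≢ 𝟎 × VanishesOnT u × value u (r x) ≡ 0F
  through x =
    let u , u≢0 , zeros = common-annihilator ℕ.≤-refl λ l → if isᵢ l then lookup k (r x) else lookup k (t l)
    in u , u≢0 , fifth u (λ l l≢i → subst (λ b → dot u (if b then lookup k (r x) else lookup k (t l)) ≡ 0F) (isᵢ-no l≢i) (zeros l))
         , subst (λ b → dot u (if b then lookup k (r x) else lookup k (t i)) ≡ 0F) isᵢ-yes (zeros i)
    where
    isᵢ : Fin 5 → Bool
    isᵢ l = does (l ≟ i)
    isᵢ-yes : isᵢ i ≡ true
    isᵢ-yes = dec-true (i ≟ i) refl
    isᵢ-no : ∀ {l} → l ≢ i → isᵢ l ≡ false
    isᵢ-no l≢i = dec-false (_ ≟ i) l≢i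

  two-zeros : ∀ {u} → u ≢ 𝟎 → VanishesOnT u → ∀ {x y} → x ≢ y →
              value u (r x) ≡ 0F → value u (r y) ≡ 0F → ⊥
  two-zeros {u} u≢0 vanish {x} {y} x≢y zx zy =
    few u u≢0 (append t r′)
      (append-injective _≡_ sym t-injective r′-injective λ { l 0F → t≢r l x ; l 1F → t≢r l y })
      (append-all (λ j → value u j ≡ 0F) vanish λ { 0F → zx ; 1F → zy })
    where
    r′ : Fin 2 → Fin 12
    r′ 0F = r x
    r′ 1F = r y
    r′-injective : Injective _≡_ _≡_ r′
    r′-injective {0F} {0F} _  = refl
    r′-injective {0F} {1F} eq = contradiction (r-injective eq) x≢y
    r′-injective {1F} {0F} eq = contradiction (sym (r-injective eq)) x≢y
    r′-injective {1F} {1F} _  = refl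

  module _ (u v : V) (u≢0 : u ≢ 𝟎) (v≢0 : v ≢ 𝟎) (u-t : VanishesOnT u) (v-t : VanishesOnT v)
           (u-0 : value u (r 0F) ≡ 0F) (v-1 : value v (r 1F) ≡ 0F)
    where

    u-nonzero : ∀ x → x ≢ 0F → value u (r x) ≢ 0F
    u-nonzero x x≢0 eq = two-zeros u≢0 u-t x≢0 eq u-0

    v-nonzero : ∀ x → x ≢ 1F → value v (r x) ≢ 0F
    v-nonzero x x≢1 eq = two-zeros v≢0 v-t x≢1 eq v-1

    -- Plays the part of the quotient of the two values where `v` does not vanish.
    product : Fin 7 → GF3
    product x = value u (r x) *₃ value v (r x)

    product-nonzero : ∀ x → x ≢ 0F → x ≢ 1F → product x ≢ 0F
    product-nonzero x x≢0 x≢1 =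
      *-nonzero (value u (r x)) (value v (r x)) (u-nonzero x x≢0) (v-nonzero x x≢1)

    value-⊕⊙ : ∀ a j → value (u ⊕ a ⊙ v) j ≡ value u j +₃ a *₃ value v j
    value-⊕⊙ a j = let w = lookup k j in begin
      dot (u ⊕ a ⊙ v) w            ≡⟨ dot-comm (u ⊕ a ⊙ v) w ⟩
      dot w (u ⊕ a ⊙ v)            ≡⟨ dot-⊕ w u (a ⊙ v) ⟩
      dot w u +₃ dot w (a ⊙ v)     ≡⟨ cong (dot w u +₃_) (dot-⊙ a w v) ⟩
      dot w u +₃ a *₃ dot w v      ≡⟨ cong₂ (λ b c → b +₃ a *₃ c) (dot-comm w u) (dot-comm w v) ⟩
      dot u w +₃ a *₃ dot v w      ∎
      where open ≡-Reasoning

    no-collision : ∀ x y → x ≢ y → x ≢ 0F → x ≢ 1F → y ≢ 1F → product x ≢ product y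
    no-collision x y x≢y x≢0 x≢1 y≢1 eq = two-zeros {w} w≢0 w-t x≢y w-x w-y
      where
      -- Minus the common quotient, so that `w` vanishes at both `r x` and `r y`.
      a = 2F *₃ product x
      w = u ⊕ a ⊙ v

      w-t : VanishesOnT w
      w-t l = trans (value-⊕⊙ a (t l))
        (cong₂ _+₃_ (u-t l) (trans (cong (a *₃_) (v-t l)) (*-comm a 0F)))

      w-x : value w (r x) ≡ 0F
      w-x = trans (value-⊕⊙ a (r x)) (eliminate (value u (r x)) (value v (r x)) (v-nonzero x x≢1))

      w-y : value w (r y) ≡ 0F
      w-y = trans (value-⊕⊙ a (r y))
        (trans (cong (λ p → value u (r y) +₃ (2F *₃ p) *₃ value v (r y)) eq)
               (eliminate (value u (r y)) (value v (r y)) (v-nonzero y y≢1)))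

      -- At `r 0F` the functional `u` vanishes and `v` does not, so `w` has a nonzero value there.
      w≢0 : w ≢ 𝟎
      w≢0 w≡0 = *-nonzero a (value v (r 0F))
        (*-nonzero 2F (product x) (λ ()) (product-nonzero x x≢0 x≢1)) (v-nonzero 0F λ ())
        (begin
          a *₃ value v (r 0F)                      ≡⟨ +-identityˡ _ ⟨
          0F +₃ a *₃ value v (r 0F)                ≡⟨ cong (_+₃ a *₃ value v (r 0F)) u-0 ⟨
          value u (r 0F) +₃ a *₃ value v (r 0F)    ≡⟨ value-⊕⊙ a (r 0F) ⟨
          value w (r 0F)                           ≡⟨ cong (λ z → value z (r 0F)) w≡0 ⟩
          value 𝟎 (r 0F)                           ≡⟨ dot-comm 𝟎 (lookup k (r 0F)) ⟩
          dot (lookup k (r 0F)) 𝟎                  ≡⟨ dot-𝟎 (lookup k (r 0F)) ⟩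
          0F                                       ∎)
        where open ≡-Reasoning

    impossible : ⊥
    impossible =
      [_,_]′ (no-collision 2F 3F (λ ()) (λ ()) (λ ()) (λ ()))
      ([_,_]′ (no-collision 2F 4F (λ ()) (λ ()) (λ ()) (λ ()))
        (no-collision 3F 4F (λ ()) (λ ()) (λ ()) (λ ())))
      (three-nonzero (product 2F) (product 3F) (product 4F)
        (product-nonzero 2F (λ ()) (λ ())) (product-nonzero 3F (λ ()) (λ ()))
        (product-nonzero 4F (λ ()) (λ ())))

  dependency-impossible : ⊥
  dependency-impossible =
    let u , u≢0 , u-t , u-0 = through 0F
        v , v≢0 , v-t , v-1 = through 1F
    in impossible u v u≢0 v≢0 u-t v-t u-0 v-1

-- If five points t were dependent, every hyperplane through a suitable four of
-- them would contain all five, so for every other point r x some hyperplane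
-- meets K in t and r x only. Take the equations u and v of those through r 0 and r 1.
-- Off t ∪ {r 0, r 1} their quotient is ±1, so it agrees at two of r 2, r 3, r 4,
-- and u + v or u - v vanishes at seven points.
minimum-distance : (k : Vec V 12) → FewZeros (lookup k) → MinimumDistance6 k
minimum-distance k few c dependency wt≤5 = decidable-stable (c ≟ᵥ 𝟎) λ c≢0 →
  let t , t-injective , t-covers = support-cover c (s≤s (s≤s (s≤s (s≤s (s≤s z≤n))))) wt≤5
      j , cⱼ≢0 = ≢𝟎⇒nonzero-entry c c≢0
      i , tᵢ≡j = t-covers j cⱼ≢0
      open Complement (complement {5} {7} t t-injective)
  in dependency-impossible k few c dependency t t-injective t-covers
       i (subst (λ j → lookup c j ≢ 0F) (sym tᵢ≡j) cⱼ≢0) rest rest-injective disjoint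

-- Classification of the affine points

infixl 6 _⊖_
_⊖_ : Vect n → Vect n → Vect n
u ⊖ v = u ⊕ 2F ⊙ v

ones : Vect n
ones = replicate _ 1F

-- The six points of K off the hyperplane spanned by P₀, …, P₄, in suitable affine
-- coordinates.
s : Fin 6 → Vect 5
s 0F = 0F ∷ 0F ∷ 0F ∷ 0F ∷ 0F ∷ []
s 1F = 0F ∷ 1F ∷ 1F ∷ 2F ∷ 2F ∷ []
s 2F = 1F ∷ 0F ∷ 2F ∷ 1F ∷ 2F ∷ []
s 3F = 1F ∷ 2F ∷ 0F ∷ 2F ∷ 1F ∷ []
s 4F = 2F ∷ 1F ∷ 2F ∷ 0F ∷ 1F ∷ []
s 5F = 2F ∷ 2F ∷ 1F ∷ 1F ∷ 0F ∷ []

-- x ⊖ c ⊙ ones and c are the coefficients at P₀, …, P₄ and P₅ of a dependency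
-- that involves only two further points of K.
GoodDifference : Vect 5 → Set
GoodDifference x = ∀ c → 4 ℕ.≤ weight (x ⊖ c ⊙ ones ++ c ∷ [])

goodDifference? : ∀ x → Dec (GoodDifference x)
goodDifference? x = all? λ c → 4 ℕ.≤? weight (x ⊖ c ⊙ ones ++ c ∷ [])

allVects : ∀ n → List (Vect n)
allVects zero    = [] ∷ []
allVects (suc n) = concatMap (λ v → (0F ∷ v) ∷ (1F ∷ v) ∷ (2F ∷ v) ∷ []) (allVects n)

∈-allVects : (v : Vect n) → v ∈ˡ allVects n
∈-allVects []      = here refl
∈-allVects (x ∷ v) = ∈-concatMap⁺ _ (lose (∈-allVects v) (x∷v∈ x))
  where
  x∷v∈ : ∀ x → (x ∷ v) ∈ˡ ((0F ∷ v) ∷ (1F ∷ v) ∷ (2F ∷ v) ∷ [])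
  x∷v∈ 0F = here refl
  x∷v∈ 1F = there (here refl)
  x∷v∈ 2F = there (there (here refl))

-- Cliques in the graph that joins vectors with good difference. Each chosen vector cuts the
-- candidates down to its neighbours, which prunes the search.
AllCliques : ∀ n → (Vec (Vect 5) n → Set) → List (Vect 5) → Set
AllCliques zero    P xs = P []
AllCliques (suc n) P xs =
  AllList (λ x → AllCliques n (P ∘ (x ∷_)) (filter (λ y → goodDifference? (y ⊖ x)) xs)) xs

allCliques? : ∀ n {P : Vec (Vect 5) n → Set} → (∀ c → Dec (P c)) → ∀ xs → Dec (AllCliques n P xs)
allCliques? zero    P? xs = P? []
allCliques? (suc n) P? xs =
  ListAll.all? (λ x → allCliques? n (P? ∘ (x ∷_)) (filter (λ y → goodDifference? (y ⊖ x)) xs)) xs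

allCliques-lookup : ∀ {n} {P : Vec (Vect 5) n → Set} {xs} → AllCliques n P xs →
  (c : Vec (Vect 5) n) → (∀ i → lookup c i ∈ˡ xs) →
  (∀ i j → i ≢ j → GoodDifference (lookup c i ⊖ lookup c j)) → P c
allCliques-lookup all []      c∈xs good = all
allCliques-lookup all (x ∷ c) c∈xs good =
  allCliques-lookup (ListAll.lookup all (c∈xs 0F)) c
    (λ i → ∈-filter⁺ (λ y → goodDifference? (y ⊖ x)) (c∈xs (suc i)) (good (suc i) 0F λ ()))
    (λ i j i≢j → good (suc i) (suc j) (i≢j ∘ Fin.suc-injective))

-- Translation to the point `x i` as origin and a sign `ε`. The result is compared with `s` as a
-- set, hence the two inclusions.
Normalized : (Fin 6 → Vect 5) → Fin 6 → GF3 → Set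
Normalized x i ε = ε ≢ 0F × (∀ j → ∃[ l ] ε ⊙ (x j ⊖ x i) ≡ s l)
                          × (∀ l → ∃[ j ] ε ⊙ (x j ⊖ x i) ≡ s l)

-- One of the six points has been moved to `𝟎`; `c` lists the other five.
Normalizable : Vec (Vect 5) 5 → Set
Normalizable c = ∃[ i ] ∃[ ε ] Normalized (lookup (𝟎 ∷ c)) i ε

normalizable? : ∀ c → Dec (Normalizable c)
normalizable? c = any? λ i → any? λ ε → ¬? (ε ≟ 0F)
  ×-dec all? (λ j → any? λ l → ε ⊙ (x j ⊖ x i) ≟ᵥ s l)
  ×-dec all? (λ l → any? λ j → ε ⊙ (x j ⊖ x i) ≟ᵥ s l)
  where
  x : Fin 6 → Vect 5
  x = lookup (𝟎 ∷ c)

abstract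
  goodDifferences : List (Vect 5)
  goodDifferences = filter goodDifference? (allVects 5)

  ∈-goodDifferences : ∀ v → GoodDifference v → v ∈ˡ goodDifferences
  ∈-goodDifferences v good = ∈-filter⁺ goodDifference? (∈-allVects v) good

  cliques-normalizable : AllCliques 5 Normalizable goodDifferences
  cliques-normalizable = toWitness {a? = allCliques? 5 normalizable? goodDifferences} _

  -- The entries themselves must be good because they are the differences from the sixth point `𝟎`.
  cliques-are-normalizable : ∀ c → (∀ i → GoodDifference (lookup c i)) →
    (∀ i j → i ≢ j → GoodDifference (lookup c i ⊖ lookup c j)) → Normalizable c
  cliques-are-normalizable c good = allCliques-lookup {P = Normalizable} {goodDifferences}
    cliques-normalizable c (λ i → ∈-goodDifferences (lookup c i) (good i))

-- The hyperplane spanned by five points of K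

≈-sym : ∀ P Q → P ≈ Q → Q ≈ P
≈-sym P Q = Setoid.sym Points {P} {Q}

≈-trans : ∀ P Q R → P ≈ Q → Q ≈ R → P ≈ R
≈-trans P Q R = Setoid.trans Points {P} {Q} {R}

record Extension (S : PointSet) (P : Fin m → Point) (n : ℕ) : Set₁ where
  field
    rest           : Fin n → Point
    rest∈          : ∀ j → rest j ∈ points S
    rest-injective : Injective _≡_ _≈_ rest
    disjoint       : ∀ i j → ¬ (P i ≈ rest j)
    covers         : ∀ R → R ∈ points S → (∃[ i ] P i ≈ R) ⊎ (∃[ j ] rest j ≈ R)

  append∈ : (∀ i → P i ∈ points S) → ∀ i → append P rest i ∈ points S
  append∈ P∈S = append-all (points S) P∈S rest∈

  append-≉ : Injective _≡_ _≈_ P → Injective _≡_ _≈_ (append P rest)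
  append-≉ P-injective =
    append-injective _≈_ (λ {Q} {R} → ≈-sym Q R) P-injective rest-injective disjoint

extend : (S : PointSet) → S HasSize (m ℕ.+ n) → (P : Fin m → Point) → Injective _≡_ _≈_ P →
         (∀ i → P i ∈ points S) → Extension S P n
extend {m} {n} S size P P-injective P∈S = record
  { rest           = enumerate ∘ C.rest
  ; rest∈          = λ j → proj₂ (Bijection.to size (C.rest j))
  ; rest-injective = λ eq → C.rest-injective (Bijection.injective size eq)
  ; disjoint       = λ i j Pᵢ≈Rⱼ → C.disjoint i j (Bijection.injective size
      (≈-trans (enumerate (index (P i) (P∈S i))) (P i) (enumerate (C.rest j))
               (enumerate-index (P i) (P∈S i)) Pᵢ≈Rⱼ))
  ; covers         = covers
  }
  where
  enumerate : Fin (m ℕ.+ n) → Point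
  enumerate l = proj₁ (Bijection.to size l)

  index : ∀ R → R ∈ points S → Fin (m ℕ.+ n)
  index R R∈S = proj₁ (Bijection.strictlySurjective size (R , R∈S))

  enumerate-index : ∀ R R∈S → enumerate (index R R∈S) ≈ R
  enumerate-index R R∈S = proj₂ (Bijection.strictlySurjective size (R , R∈S))

  module C = Complement (complement {m} {n} (λ i → index (P i) (P∈S i)) λ {i} {j} eq →
    P-injective (≈-trans (P i) (enumerate (index (P i) (P∈S i))) (P j)
      (≈-sym (enumerate (index (P i) (P∈S i))) (P i) (enumerate-index (P i) (P∈S i)))
      (subst (λ l → enumerate l ≈ P j) (sym eq) (enumerate-index (P j) (P∈S j)))))

  covers : ∀ R → R ∈ points S → (∃[ i ] P i ≈ R) ⊎ (∃[ j ] enumerate (C.rest j) ≈ R)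
  covers R R∈S with C.covers (index R R∈S)
  ... | inj₁ (i , eq) = inj₁ (i , ≈-trans (P i) (enumerate (index (P i) (P∈S i))) R
          (≈-sym (enumerate (index (P i) (P∈S i))) (P i) (enumerate-index (P i) (P∈S i)))
          (subst (λ l → enumerate l ≈ R) (sym eq) (enumerate-index R R∈S)))
  ... | inj₂ (j , eq) = inj₂ (j , subst (λ l → enumerate l ≈ R) (sym eq) (enumerate-index R R∈S))

append-generators : (P : Fin m → Point) (Q : Fin n → Point) (p : Vec V m) (q : Vec V n) →
  (∀ i → generator (P i) ∝ lookup p i) → (∀ j → generator (Q j) ∝ lookup q j) →
  ∀ i → generator (append P Q i) ∝ lookup (p ++ q) i
append-generators {m} P Q p q P∝p Q∝q i rewrite Vec.lookup-splitAt m p q i with splitAt m i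
... | inj₁ j = P∝p j
... | inj₂ j = Q∝q j

solve-for : ∀ a (v w : Vect n) → a ≢ 0F → a ⊙ v ⊕ w ≡ 𝟎 → (2F *₃ a) ⊙ w ≡ v
solve-for a []      []      a≢0 eq = refl
solve-for a (x ∷ v) (y ∷ w) a≢0 eq =
  cong₂ _∷_ (solve-head a x y a≢0 (cong head eq)) (solve-for a v w a≢0 (cong tail eq))

drop-0⊙ : (v w : Vect n) → 0F ⊙ v ⊕ w ≡ 𝟎 → w ≡ 𝟎
drop-0⊙ v w eq = trans (sym (⊕-identityˡ w)) (trans (cong (_⊕ w) (sym (0⊙ v))) eq)

independent-∷ : (b : Vec V d) → LinearlyIndependent b → ∀ v → (∀ c → linComb c b ≢ v) →
                LinearlyIndependent (v ∷ b)
independent-∷ b independent v v∉span (x ∷ c) eq with x ≟ 0F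
... | yes refl = cong (0F ∷_) (independent c (drop-0⊙ v (linComb c b) eq))
... | no x≢0 = contradiction
  (trans (comb-⊙ (2F *₃ x) c b) (solve-for x v (linComb c b) x≢0 eq))
  (v∉span ((2F *₃ x) ⊙ c))

-- Seven vectors in dimension six are dependent, and the coefficient of `v` in a dependency cannot
-- be zero.
spanning : (b : Vec V 6) → LinearlyIndependent b → ∀ v → ∃[ c ] linComb c b ≡ v
spanning b independent v =
  let c , c≢0 , eq = nontrivial-kernel (comb-linear (v ∷ b)) ℕ.≤-refl in solution c c≢0 eq
  where
  solution : ∀ c → c ≢ 𝟎 → comb c (v ∷ b) ≡ 𝟎 → ∃[ c ] linComb c b ≡ v
  solution (x ∷ c) xc≢0 eq with x ≟ 0F
  ... | yes refl = contradiction (cong (0F ∷_) (independent c (drop-0⊙ v (linComb c b) eq))) xc≢0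
  ... | no x≢0 = (2F *₃ x) ⊙ c ,
    trans (comb-⊙ (2F *₃ x) c b) (solve-for x v (linComb c b) x≢0 eq)

weight≤ : (c : Vect n) → weight c ℕ.≤ n
weight≤ []          = z≤n
weight≤ (0F ∷ c)    = ℕ.m≤n⇒m≤1+n (weight≤ c)
weight≤ (suc _ ∷ c) = s≤s (weight≤ c)

weight-zero-entry : (c : Vect n) → ∀ i → lookup c i ≡ 0F → suc (weight c) ℕ.≤ n
weight-zero-entry (0F ∷ c)    i       eq = s≤s (weight≤ c)
weight-zero-entry (suc _ ∷ c) (suc i) eq = s≤s (weight-zero-entry c i eq)

weight-++ : (c : Vect m) (e : Vect n) → weight (c ++ e) ≡ weight c ℕ.+ weight e
weight-++ []          e = refl
weight-++ (0F ∷ c)    e = weight-++ c e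
weight-++ (suc _ ∷ c) e = cong suc (weight-++ c e)

weight-𝟎 : ∀ n → weight (𝟎 {n}) ≡ 0
weight-𝟎 zero    = refl
weight-𝟎 (suc n) = weight-𝟎 n

linComb-++𝟎 : ∀ c (p : Vec V m) (q : Vec V n) → linComb (c ++ 𝟎) (p ++ q) ≡ linComb c p
linComb-++𝟎 c p q =
  trans (comb-++ c p 𝟎 q) (trans (cong (linComb c p ⊕_) (comb-𝟎 q)) (⊕-identityʳ (linComb c p)))

weight-++𝟎 : (c : Vect m) → weight (c ++ 𝟎 {n}) ≡ weight c
weight-++𝟎 {n = n} c =
  trans (weight-++ c 𝟎) (trans (cong (weight c ℕ.+_) (weight-𝟎 n)) (ℕ.+-identityʳ (weight c)))

replicate-++ : ∀ m n → 𝟎 {m ℕ.+ n} ≡ 𝟎 {m} ++ 𝟎 {n}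
replicate-++ zero    n = refl
replicate-++ (suc m) n = cong (0F ∷_) (replicate-++ m n)

-- Padding with zeros makes a dependency of `p` one of `p ++ q` with the same weight.
distance-prefix : (p : Vec V m) (q : Vec V n) → MinimumDistance6 (p ++ q) → MinimumDistance6 p
distance-prefix {m} {n} p q distance c eq wt≤5 =
  Vec.++-injectiveˡ c 𝟎 (trans
    (distance (c ++ 𝟎) (trans (linComb-++𝟎 c p q) eq) (subst (ℕ._≤ 5) (sym (weight-++𝟎 c)) wt≤5))
    (replicate-++ m n))

distance⇒independent : (p : Vec V 5) → MinimumDistance6 p → LinearlyIndependent p
distance⇒independent p distance c eq = distance c eq (weight≤ c)

generators : (Fin n → Point) → Vec V n
generators P = tabulate (generator ∘ P)

generator∝ : (P : Fin n → Point) → ∀ i → generator (P i) ∝ lookup (generators P) i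
generator∝ P i =
  subst (generator (P i) ∝_) (sym (Vec.lookup∘tabulate (generator ∘ P) i)) (∝-refl (generator (P i)))

module _ (K : PointSet) (sections : HasSections036 K) where

  independent-five : K HasSize 12 → (P : Fin 5 → Point) → Injective _≡_ _≈_ P →
                     (∀ i → P i ∈ points K) → LinearlyIndependent (generators P)
  independent-five size P P-injective P∈K =
    distance⇒independent (generators P) (distance-prefix (generators P) (generators rest)
      (minimum-distance (generators P ++ generators rest)
        (few-zeros K sections (append P rest) (append-≉ P-injective) (append∈ P∈K)
          (lookup (generators P ++ generators rest))
          (append-generators P rest (generators P) (generators rest) (generator∝ P) (generator∝ rest)))))
    where open Extension (extend {m = 5} {n = 7} K size P P-injective P∈K)

  -- Among 0, 3 and 6 only 6 is at least 5; this is the source of the sixth point of the hyperplane.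
  six-section : (H : Hyperplane) → (∀ {n} → (pointsOf H ⊓ K) HasSize n → 5 ℕ.≤ n) →
                (pointsOf H ⊓ K) HasSize 6
  six-section H 5≤ with sections H
  ... | _ , here refl                 , size with () ← 5≤ size
  ... | _ , there (here refl)         , size with s≤s (s≤s (s≤s ())) ← 5≤ size
  ... | _ , there (there (here refl)) , size = size

  sixth-point : (P : Fin 5 → Point) → Injective _≡_ _≈_ P → (∀ i → P i ∈ points K) →
                LinearlyIndependent (generators P) →
                ∃[ R ] R ∈ points K × (∀ i → ¬ (P i ≈ R)) ×
                       (∃[ c ] linComb c (generators P) ≡ generator R)
  sixth-point P P-injective P∈K independent =
    rest 0F , proj₂ (rest∈ 0F) , (λ i → disjoint i 0F) , proj₁ (rest∈ 0F) (generator∈ (rest 0F))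
    where
    H : Hyperplane
    H = span (generators P) independent

    P∈H : ∀ i → P i ∈ points (pointsOf H ⊓ K)
    P∈H i = (λ {v} → ∝⇒⊆ (P i) H (unit i ,
      trans (comb-unit i (generators P)) (Vec.lookup∘tabulate (generator ∘ P) i)) {v}) , P∈K i

    open Extension (extend {m = 5} {n = 1} (pointsOf H ⊓ K)
      (six-section H λ size → size-bound (pointsOf H ⊓ K) size P P-injective P∈H)
      P P-injective P∈H)

comb-scale : ∀ c a (b : Vec (Vect n) d) → comb c (zipWith _⊙_ a b) ≡ comb (zipWith _*₃_ c a) b
comb-scale []      []      []      = refl
comb-scale (x ∷ c) (a ∷ as) (v ∷ b) = cong₂ _⊕_ (sym (⊙-assoc x a v)) (comb-scale c as b)

ones-* : (a : Vect n) → zipWith _*₃_ ones a ≡ a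
ones-* []      = refl
ones-* (x ∷ a) = cong₂ _∷_ (*-identityˡ x) (ones-* a)

zipWith-*-𝟎 : ∀ (c a : Vect n) → (∀ i → lookup a i ≢ 0F) → zipWith _*₃_ c a ≡ 𝟎 → c ≡ 𝟎
zipWith-*-𝟎 []      []      a≢0 eq = refl
zipWith-*-𝟎 (x ∷ c) (y ∷ a) a≢0 eq = cong₂ _∷_
  (*-cancel-0 y x (a≢0 0F) (trans (*-comm y x) (cong head eq)))
  (zipWith-*-𝟎 c a (a≢0 ∘ suc) (cong tail eq))

independent-scale : ∀ a (b : Vec V d) → (∀ i → lookup a i ≢ 0F) → LinearlyIndependent b →
                    LinearlyIndependent (zipWith _⊙_ a b)
independent-scale a b a≢0 independent c eq =
  zipWith-*-𝟎 c a a≢0 (independent (zipWith _*₃_ c a) (trans (sym (comb-scale c a b)) eq))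

unit-injective : ∀ (j l : Fin 6) → unit l ≡ unit j → l ≡ j
unit-injective = toWitness {a? = all? λ j → all? λ l → unit l ≟ᵥ unit j →-dec l ≟ j} _

weight-unit-⊖ : ∀ (j l : Fin 6) → weight (unit l ⊖ unit j) ℕ.≤ 2
weight-unit-⊖ = toWitness {a? = all? λ j → all? λ l → weight (unit l ⊖ unit j) ℕ.≤? 2} _

comb-⊖ : ∀ c c′ (b : Vec (Vect n) d) → comb (c ⊖ c′) b ≡ comb c b ⊖ comb c′ b
comb-⊖ c c′ b = trans (comb-⊕ c (2F ⊙ c′) b) (cong (comb c b ⊕_) (comb-⊙ 2F c′ b))

-- The entries of `p` are scaled so that their sum represents `P₅`. Each `Q j` is represented with
-- coefficient 1 at `origin`, which makes `x j` its affine coordinates.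
record Coordinates (K : PointSet) (P : Fin 5 → Point) : Set₁ where
  field
    P₅          : Point
    P₅∈K        : P₅ ∈ points K
    Q           : Fin 6 → Point
    Q∈K         : ∀ j → Q j ∈ points K
    covers      : ∀ R → R ∈ points K → (∃[ i ] P i ≈ R) ⊎ P₅ ≈ R ⊎ (∃[ j ] Q j ≈ R)
    p           : Vec V 5
    independent : LinearlyIndependent p
    origin      : V
    x           : Fin 6 → Vect 5
    P∝p         : ∀ i → generator (P i) ∝ lookup p i
    P₅≡         : generator P₅ ≡ linComb ones p
    Q∝          : ∀ j → generator (Q j) ∝ origin ⊕ linComb (x j) p
    outside     : ∀ j c → ¬ (generator (Q j) ∝ linComb c p)
    good        : ∀ j l → j ≢ l → GoodDifference (x j ⊖ x l)

module _ (K : PointSet) (sections : HasSections036 K)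
         (P : Fin 5 → Point) (P∈K : ∀ i → P i ∈ points K)
         (P₅ : Point) (P₅∈K : P₅ ∈ points K)
  where

  P₀₋₅ : Fin 6 → Point
  P₀₋₅ = append P (λ (_ : Fin 1) → P₅)

  P₀₋₅∈K : ∀ i → P₀₋₅ i ∈ points K
  P₀₋₅∈K = append-all (points K) P∈K (λ _ → P₅∈K)

  module _ (P₀₋₅-injective : Injective _≡_ _≈_ P₀₋₅) (extension : Extension K P₀₋₅ 6) where

    open Extension extension renaming (rest to Q; rest∈ to Q∈K; covers to P₀₋₅Q-covers)

    distance : (p : Vec V 5) (g : V) (q : Vec V 6) →
      (∀ i → generator (P i) ∝ lookup p i) → generator P₅ ∝ g → (∀ j → generator (Q j) ∝ lookup q j) →
      MinimumDistance6 ((p ++ g ∷ []) ++ q)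
    distance p g q P∝p P₅∝g Q∝q = minimum-distance k
      (few-zeros K sections (append P₀₋₅ Q) (append-≉ P₀₋₅-injective) (append∈ P₀₋₅∈K)
        (lookup k)
        (append-generators P₀₋₅ Q (p ++ g ∷ []) q
          (append-generators P (λ _ → P₅) p (g ∷ []) P∝p λ { 0F → P₅∝g }) Q∝q))
      where
      k : Vec V 12
      k = (p ++ g ∷ []) ++ q

    -- A zero coefficient would leave a dependency between `P₅` and at most four of the `P i`.
    nonzero-coefficients : ∀ a → linComb a (generators P) ≡ generator P₅ → ∀ i → lookup a i ≢ 0F
    nonzero-coefficients a eq i aᵢ≡0 = 2F≢0F (cong head (Vec.++-injectiveʳ a 𝟎 (trans
        (distance-prefix (generators P ++ generator P₅ ∷ []) (generators Q)
          (distance (generators P) (generator P₅) (generators Q)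
            (generator∝ P) (∝-refl (generator P₅)) (generator∝ Q))
          (a ++ 2F ∷ [])
          (begin
            linComb (a ++ 2F ∷ []) (generators P ++ generator P₅ ∷ [])
              ≡⟨ comb-++ a (generators P) (2F ∷ []) (generator P₅ ∷ []) ⟩
            linComb a (generators P) ⊕ linComb (2F ∷ []) (generator P₅ ∷ [])
              ≡⟨ cong₂ _⊕_ eq (linComb-singleton 2F (generator P₅)) ⟩
            generator P₅ ⊖ generator P₅
              ≡⟨ solve (generator P₅ ∷ []) (var 0F :+ 2F :· var 0F) (0F :· var 0F) refl ⟩
            0F ⊙ generator P₅
              ≡⟨ 0⊙ (generator P₅) ⟩
            𝟎 ∎)
          (subst (ℕ._≤ 5) (sym (trans (weight-++ a (2F ∷ [])) (ℕ.+-comm (weight a) 1)))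
            (weight-zero-entry a i aᵢ≡0)))
        (replicate-++ 5 1))))
      where
      open ≡-Reasoning
      2F≢0F : ¬ (_≡_ {A = GF3} 2F 0F)
      2F≢0F ()

    -- Subtracting the representatives of `Q j` and `Q l` cancels `origin` and expresses their
    -- difference in `p`. Moving the multiple `c` of the sum of `p` over to `P₅` gives a dependency;
    -- weight at most 3 on the frame and 2 on the affine points would be too little.
    good-differences : (p : Vec V 5) (origin : V) (x : Fin 6 → Vect 5) →
      (∀ i → generator (P i) ∝ lookup p i) → generator P₅ ≡ linComb ones p →
      (∀ j → generator (Q j) ∝ origin ⊕ linComb (x j) p) →
      ∀ j l → j ≢ l → GoodDifference (x j ⊖ x l)
    good-differences p origin x P∝p P₅≡ Q∝ j l j≢l c = ℕ.≰⇒> λ wt≤3 → j≢l (sym (unit-injective j l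
      (u⊖v≡𝟎⇒u≡v (unit l) (unit j) (Vec.++-injectiveʳ e 𝟎 (trans
        (distance p (linComb ones p) q P∝p (subst (_∝ linComb ones p) (sym P₅≡) (∝-refl _)) Q∝q
          (e ++ (unit l ⊖ unit j)) dependency
          (subst (ℕ._≤ 5) (sym (weight-++ e (unit l ⊖ unit j))) (ℕ.+-mono-≤ wt≤3 (weight-unit-⊖ j l))))
        (replicate-++ 6 6))))))
      where
      open ≡-Reasoning
      q : Vec V 6
      q = tabulate λ j → origin ⊕ linComb (x j) p

      lookup-q : ∀ j → lookup q j ≡ origin ⊕ linComb (x j) p
      lookup-q = Vec.lookup∘tabulate _

      Q∝q : ∀ j → generator (Q j) ∝ lookup q j
      Q∝q j = subst (generator (Q j) ∝_) (sym (lookup-q j)) (Q∝ j)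

      e : Vect 6
      e = (x j ⊖ x l) ⊖ c ⊙ ones ++ c ∷ []

      A B G : V
      A = linComb (x j) p
      B = linComb (x l) p
      G = linComb ones p

      dependency : linComb (e ++ (unit l ⊖ unit j)) ((p ++ G ∷ []) ++ q) ≡ 𝟎
      dependency = begin
        linComb (e ++ (unit l ⊖ unit j)) ((p ++ G ∷ []) ++ q)
          ≡⟨ comb-++ e (p ++ G ∷ []) (unit l ⊖ unit j) q ⟩
        linComb e (p ++ G ∷ []) ⊕ linComb (unit l ⊖ unit j) q
          ≡⟨ cong₂ _⊕_
               (trans (comb-++ ((x j ⊖ x l) ⊖ c ⊙ ones) p (c ∷ []) (G ∷ []))
                 (cong₂ _⊕_
                   (trans (comb-⊖ (x j ⊖ x l) (c ⊙ ones) p)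
                     (cong₂ _⊖_ (comb-⊖ (x j) (x l) p) (comb-⊙ c ones p)))
                   (linComb-singleton c G)))
               (trans (comb-⊖ (unit l) (unit j) q)
                 (cong₂ _⊖_ (trans (comb-unit l q) (lookup-q l)) (trans (comb-unit j q) (lookup-q j)))) ⟩
        (((A ⊖ B) ⊖ c ⊙ G) ⊕ c ⊙ G) ⊕ ((origin ⊕ B) ⊖ (origin ⊕ A))
          ≡⟨ solve (A ∷ B ∷ c ⊙ G ∷ origin ∷ [])
               ((((var 0F :+ 2F :· var 1F) :+ 2F :· var 2F) :+ var 2F) :+
                 ((var 3F :+ var 1F) :+ 2F :· (var 3F :+ var 0F)))
               (0F :· var 0F) refl ⟩
        0F ⊙ A
          ≡⟨ 0⊙ A ⟩
        𝟎 ∎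

    -- `Q j` lies off the hyperplane, so its coefficient at `generator (Q 0F)` is nonzero and can be
    -- scaled to 1.
    coordinates-in-basis : (p : Vec V 5) → LinearlyIndependent p →
      (∀ j c → ¬ (generator (Q j) ∝ linComb c p)) →
      ∀ j → ∃[ x ] generator (Q j) ∝ generator (Q 0F) ⊕ linComb x p
    coordinates-in-basis p independent outside j =
      normalize (spanning (generator (Q 0F) ∷ p) q₀p-independent (generator (Q j)))
      where
      q₀p-independent : LinearlyIndependent (generator (Q 0F) ∷ p)
      q₀p-independent = independent-∷ p independent (generator (Q 0F)) λ c eq →
        outside 0F c (1F , trans (1⊙ (linComb c p)) eq)

      normalize : (∃[ c ] linComb c (generator (Q 0F) ∷ p) ≡ generator (Q j)) →
                  ∃[ x ] generator (Q j) ∝ generator (Q 0F) ⊕ linComb x p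
      normalize (a ∷ z , eq) with a ≟ 0F
      ... | yes refl = contradiction
        (1F , trans (1⊙ (linComb z p)) (trans (sym (⊕-identityˡ (linComb z p)))
          (trans (cong (_⊕ linComb z p) (sym (0⊙ (generator (Q 0F))))) eq)))
        (outside j z)
      ... | no a≢0 = a ⊙ z , a , trans (⊙-distribˡ a (generator (Q 0F)) (linComb (a ⊙ z) p))
        (trans (cong (a ⊙ generator (Q 0F) ⊕_)
          (trans (cong (a ⊙_) (comb-⊙ a z p)) (⊙-inverse a≢0 (linComb z p)))) eq)

    module _ (generators-independent : LinearlyIndependent (generators P))
             (a : Vect 5) (a-eq : linComb a (generators P) ≡ generator P₅)
      where

      private
        a≢0 : ∀ i → lookup a i ≢ 0F
        a≢0 = nonzero-coefficients a a-eq

        p : Vec V 5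
        p = zipWith _⊙_ a (generators P)

        p-independent : LinearlyIndependent p
        p-independent = independent-scale a (generators P) a≢0 generators-independent

        lookup-p : ∀ i → lookup p i ≡ lookup a i ⊙ generator (P i)
        lookup-p i = trans (Vec.lookup-zipWith _⊙_ i a (generators P))
          (cong (lookup a i ⊙_) (Vec.lookup∘tabulate (generator ∘ P) i))

        P∝p : ∀ i → generator (P i) ∝ lookup p i
        P∝p i = lookup a i ,
          trans (cong (lookup a i ⊙_) (lookup-p i)) (⊙-inverse (a≢0 i) (generator (P i)))

        P₅≡ : generator P₅ ≡ linComb ones p
        P₅≡ = sym (trans (comb-scale ones a (generators P))
          (trans (cong (λ c → linComb c (generators P)) (ones-* a)) a-eq))

        H : Hyperplane
        H = span p p-independent

        in-H : ∀ {v} i → v ∝ lookup p i → v ∈ vectorsOf H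
        in-H i (b , refl) = Subspace.·-closed (proj₁ H) b (unit i , comb-unit i p)

        -- Otherwise `H` would contain seven points of K: the frame and `Q j`.
        outside : ∀ j c → ¬ (generator (Q j) ∝ linComb c p)
        outside j c (b , eq) = no-seven K sections H (append P₀₋₅ (λ (_ : Fin 1) → Q j))
          (append-injective _≈_ (λ {R} {S} → ≈-sym R S) P₀₋₅-injective
            (λ { {0F} {0F} _ → refl }) (λ i _ → disjoint i j))
          (append-all (points K) P₀₋₅∈K (λ _ → Q∈K j))
          (append-all (λ R → generator R ∈ vectorsOf H)
            (append-all (λ R → generator R ∈ vectorsOf H) (λ i → in-H i (P∝p i)) λ _ → ones , sym P₅≡)
            λ _ → subst (_∈ vectorsOf H) eq (Subspace.·-closed (proj₁ H) b (c , refl)))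

        covers : ∀ R → R ∈ points K → (∃[ i ] P i ≈ R) ⊎ P₅ ≈ R ⊎ (∃[ j ] Q j ≈ R)
        covers R R∈K with P₀₋₅Q-covers R R∈K
        ... | inj₂ Q≈R = inj₂ (inj₂ Q≈R)
        ... | inj₁ (i , eq) with splitAt 5 i
        ...   | inj₁ i′ = inj₁ (i′ , eq)
        ...   | inj₂ _  = inj₂ (inj₁ eq)

        x : Fin 6 → Vect 5
        x j = proj₁ (coordinates-in-basis p p-independent outside j)

        Q∝ : ∀ j → generator (Q j) ∝ generator (Q 0F) ⊕ linComb (x j) p
        Q∝ j = proj₂ (coordinates-in-basis p p-independent outside j)

      coordinates′ : Coordinates K P
      coordinates′ = record
        { P₅ = P₅ ; P₅∈K = P₅∈K ; Q = Q ; Q∈K = Q∈K ; covers = covers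
        ; p = p ; independent = p-independent ; origin = generator (Q 0F) ; x = x
        ; P∝p = P∝p ; P₅≡ = P₅≡ ; Q∝ = Q∝ ; outside = outside
        ; good = good-differences p (generator (Q 0F)) x P∝p P₅≡ Q∝
        }

coordinates : (K : PointSet) → HasSections036 K → K HasSize 12 →
  (P : Fin 5 → Point) → Injective _≡_ _≈_ P → (∀ i → P i ∈ points K) → Coordinates K P
coordinates K sections size P P-injective P∈K =
  let independent = independent-five K sections size P P-injective P∈K
      P₅ , P₅∈K , P≉P₅ , a , a-eq = sixth-point K sections P P-injective P∈K independent
      P₀₋₅-injective = append-injective _≈_ (λ {R} {S} → ≈-sym R S) P-injective
                         (λ { {0F} {0F} _ → refl }) (λ i _ → P≉P₅ i)
  in coordinates′ K sections P P∈K P₅ P₅∈K P₀₋₅-injective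
       (extend K size (append P (λ _ → P₅)) P₀₋₅-injective
         (append-all (points K) P∈K (λ _ → P₅∈K)))
       independent a a-eq

-- The standard form of K

normal-coordinates : (x : Fin 6 → Vect 5) → (∀ j l → j ≢ l → GoodDifference (x j ⊖ x l)) →
                     ∃[ i ] ∃[ ε ] Normalized x i ε
normal-coordinates x good =
  let i , ε , ε≢0 , into , onto = cliques-are-normalizable c
        (λ i → subst GoodDifference (sym (lookup-c i)) (good (suc i) 0F λ ()))
        (λ i j i≢j → subst GoodDifference (sym (cᵢ⊖cⱼ (suc i) (suc j)))
          (good (suc i) (suc j) (i≢j ∘ Fin.suc-injective)))
  in i , ε , ε≢0
   , (λ j → let l , eq = into j in l , trans (cong (ε ⊙_) (sym (cᵢ⊖cⱼ j i))) eq)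
   , (λ l → let j , eq = onto l in j , trans (cong (ε ⊙_) (sym (cᵢ⊖cⱼ j i))) eq)
  where
  c : Vec (Vect 5) 5
  c = tabulate λ j → x (suc j) ⊖ x 0F

  lookup-c : ∀ j → lookup c j ≡ x (suc j) ⊖ x 0F
  lookup-c = Vec.lookup∘tabulate _

  lookup-0∷c : ∀ j → lookup (𝟎 ∷ c) j ≡ x j ⊖ x 0F
  lookup-0∷c zero    = sym (trans
    (solve (x 0F ∷ []) (var 0F :+ 2F :· var 0F) (0F :· var 0F) refl) (0⊙ (x 0F)))
  lookup-0∷c (suc j) = lookup-c j

  cᵢ⊖cⱼ : ∀ i j → lookup (𝟎 ∷ c) i ⊖ lookup (𝟎 ∷ c) j ≡ x i ⊖ x j
  cᵢ⊖cⱼ i j = trans (cong₂ _⊖_ (lookup-0∷c i) (lookup-0∷c j))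
    (solve (x i ∷ x j ∷ x 0F ∷ [])
      ((var 0F :+ 2F :· var 2F) :+ 2F :· (var 1F :+ 2F :· var 2F)) (var 0F :+ 2F :· var 1F) refl)

-- Up to order, the columns of the usual generator matrix of the extended ternary Golay code: the
-- identity next to the Paley matrix of order 5 bordered by ones. Apart from the origin, the vectors
-- of `s` form that Paley matrix, with 1 on the edges of a pentagon and -1 on its diagonals.
data Standard : V → Set where
  vertex : ∀ i → Standard (0F ∷ unit i)
  centre : Standard (0F ∷ ones)
  affine : ∀ j → Standard (1F ∷ s j)

-- `sound` and `complete` match K with the standard vectors as sets; only `vertices` says which
-- point has which coordinates.
record StandardForm (K : PointSet) (P : Fin 5 → Point) : Set₁ where
  field
    basis       : Vec V 6
    independent : LinearlyIndependent basis
    sound       : ∀ {v} → Standard v → ∃[ R ] R ∈ points K × generator R ∝ linComb v basis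
    complete    : ∀ R → R ∈ points K → ∃[ v ] Standard v × generator R ∝ linComb v basis
    vertices    : ∀ i → generator (P i) ∝ linComb (0F ∷ unit i) basis

module _ (K : PointSet) (P : Fin 5 → Point) (P∈K : ∀ i → P i ∈ points K)
         (C : Coordinates K P) where

  open Coordinates C renaming (independent to p-independent)

  module _ (i₀ : Fin 6) (ε : GF3) (ε≢0 : ε ≢ 0F)
           (into : ∀ j → ∃[ l ] ε ⊙ (x j ⊖ x i₀) ≡ s l)
           (onto : ∀ l → ∃[ j ] ε ⊙ (x j ⊖ x i₀) ≡ s l)
    where

    private
      q : V
      q = origin ⊕ linComb (x i₀) p

      -- The sign is absorbed into the hyperplane part of the basis; a common factor keeps `P₅`
      -- proportional to the sum.
      εp : Vec V 5
      εp = zipWith _⊙_ (replicate 5 ε) p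

      basis : Vec V 6
      basis = q ∷ εp

      linComb-εp : ∀ c → linComb c εp ≡ linComb (ε ⊙ c) p
      linComb-εp c = trans (comb-scale c (replicate 5 ε) p)
        (cong (λ e → linComb e p)
          (trans (Vec.zipWith-replicate₂ _*₃_ c ε) (Vec.map-cong (λ a → *-comm a ε) c)))

      at-hyperplane : ∀ c → linComb (0F ∷ c) basis ≡ ε ⊙ linComb c p
      at-hyperplane c = trans (trans (cong (_⊕ linComb c εp) (0⊙ q)) (⊕-identityˡ (linComb c εp)))
        (trans (linComb-εp c) (comb-⊙ ε c p))

      at-affine : ∀ j l → ε ⊙ (x j ⊖ x i₀) ≡ s l → linComb (1F ∷ s l) basis ≡ origin ⊕ linComb (x j) p
      at-affine j l eq = begin
        1F ⊙ q ⊕ linComb (s l) εp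
          ≡⟨ cong₂ _⊕_ (1⊙ q) (linComb-εp (s l)) ⟩
        q ⊕ linComb (ε ⊙ s l) p
          ≡⟨ cong (λ c → q ⊕ linComb (ε ⊙ c) p) eq ⟨
        q ⊕ linComb (ε ⊙ (ε ⊙ (x j ⊖ x i₀))) p
          ≡⟨ cong (λ c → q ⊕ linComb c p) (⊙-inverse ε≢0 (x j ⊖ x i₀)) ⟩
        q ⊕ linComb (x j ⊖ x i₀) p
          ≡⟨ cong (q ⊕_) (comb-⊖ (x j) (x i₀) p) ⟩
        q ⊕ (linComb (x j) p ⊖ linComb (x i₀) p)
          ≡⟨ solve (origin ∷ linComb (x j) p ∷ linComb (x i₀) p ∷ [])
               ((var 0F :+ var 2F) :+ (var 1F :+ 2F :· var 2F)) (var 0F :+ var 1F) refl ⟩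
        origin ⊕ linComb (x j) p ∎
        where open ≡-Reasoning

      basis-independent : LinearlyIndependent basis
      basis-independent = independent-∷ εp
        (independent-scale (replicate 5 ε) p
          (λ i eq → ε≢0 (trans (sym (Vec.lookup-replicate i ε)) eq)) p-independent)
        q λ c eq → outside i₀ (ε ⊙ c)
          (subst (generator (Q i₀) ∝_) (trans (sym eq) (linComb-εp c)) (Q∝ i₀))

      hyperplane∝ : ∀ R c → generator R ∝ linComb c p → generator R ∝ linComb (0F ∷ c) basis
      hyperplane∝ R c (a , eq) = a *₃ ε , trans (⊙-assoc a ε (linComb (0F ∷ c) basis))
        (trans (cong (a ⊙_) (trans (cong (ε ⊙_) (at-hyperplane c)) (⊙-inverse ε≢0 (linComb c p)))) eq)

      vertices : ∀ i → generator (P i) ∝ linComb (0F ∷ unit i) basis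
      vertices i = hyperplane∝ (P i) (unit i)
        (subst (generator (P i) ∝_) (sym (comb-unit i p)) (P∝p i))

      P₅∝ : generator P₅ ∝ linComb (0F ∷ ones) basis
      P₅∝ = hyperplane∝ P₅ ones (subst (_∝ linComb ones p) (sym P₅≡) (∝-refl (linComb ones p)))

      sound : ∀ {v} → Standard v → ∃[ R ] R ∈ points K × generator R ∝ linComb v basis
      sound (vertex i) = P i , P∈K i , vertices i
      sound centre     = P₅ , P₅∈K , P₅∝
      sound (affine l) =
        let j , eq = onto l in Q j , Q∈K j , subst (generator (Q j) ∝_) (sym (at-affine j l eq)) (Q∝ j)

      complete : ∀ R → R ∈ points K → ∃[ v ] Standard v × generator R ∝ linComb v basis
      complete R R∈K with covers R R∈K
      ... | inj₁ (i , eq) = (0F ∷ unit i) , vertex i ,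
              ∝-trans (≈⇒∝ R (P i) (≈-sym (P i) R eq)) (vertices i)
      ... | inj₂ (inj₁ eq) = (0F ∷ ones) , centre , ∝-trans (≈⇒∝ R P₅ (≈-sym P₅ R eq)) P₅∝
      ... | inj₂ (inj₂ (j , eq)) =
              let l , eq′ = into j in (1F ∷ s l) , affine l ,
              ∝-trans (≈⇒∝ R (Q j) (≈-sym (Q j) R eq))
                (subst (generator (Q j) ∝_) (sym (at-affine j l eq′)) (Q∝ j))

    standardForm′ : StandardForm K P
    standardForm′ = record
      { basis = basis ; independent = basis-independent
      ; sound = sound ; complete = complete ; vertices = vertices }

standardForm : (K : PointSet) → HasSections036 K → K HasSize 12 →
  (P : Fin 5 → Point) → Injective _≡_ _≈_ P → (∀ i → P i ∈ points K) → StandardForm K P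
standardForm K sections size P P-injective P∈K =
  let C = coordinates K sections size P P-injective P∈K
      i , ε , ε≢0 , into , onto = normal-coordinates (Coordinates.x C) (Coordinates.good C)
  in standardForm′ K P P∈K C i ε ε≢0 into onto

-- Rigidity of the standard form

-- The terms, not the entries of `b`, are required in `U`: an entry with coefficient zero may lie
-- outside.
linComb∈-terms : ∀ (U : Subspace) c (b : Vec V d) → (∀ i → lookup c i ⊙ lookup b i ∈ vectors U) →
                 linComb c b ∈ vectors U
linComb∈-terms U []      []      _  = Subspace.0-closed U
linComb∈-terms U (x ∷ c) (v ∷ b) ∈U =
  Subspace.+-closed U (∈U 0F) (linComb∈-terms U c b (∈U ∘ suc))

lookup-unit : ∀ {i j : Fin n} → i ≢ j → lookup (unit j) i ≡ 0F
lookup-unit {i = zero}  {zero}  i≢j = contradiction refl i≢j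
lookup-unit {i = zero}  {suc j} i≢j = refl
lookup-unit {i = suc i} {zero}  i≢j = lookup-𝟎 i
lookup-unit {i = suc i} {suc j} i≢j = lookup-unit (i≢j ∘ cong suc)

lookup-units : ∀ (j : Fin n) → lookup (units n) j ≡ unit j
lookup-units zero    = refl
lookup-units (suc j) =
  trans (Vec.lookup-map j (0F ∷_) (units _)) (cong (0F ∷_) (lookup-units j))

0∷-linComb : (h : Vect 5) → linComb h (map (0F ∷_) (units 5)) ≡ 0F ∷ h
0∷-linComb h = trans
  (sym (trans (cong (_⊕ linComb h (map (0F ∷_) (units 5))) (0⊙ (unit 0F))) (⊕-identityˡ _)))
  (comb-units (0F ∷ h))

zeroAt : Fin 6 → Subspace
zeroAt i = record
  { vectors  = λ v → lookup v i ≡ 0F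
  ; 0-closed = lookup-𝟎 i
  ; +-closed = λ {u} {v} p q → trans (lookup-⊕ u v i) (cong₂ _+₃_ p q)
  ; ·-closed = λ a {v} p → trans (lookup-⊙ a v i) (trans (cong (a *₃_) p) (*-comm a 0F))
  }

equalAt : Fin 6 → Fin 6 → Subspace
equalAt i k = record
  { vectors  = λ v → lookup v i ≡ lookup v k
  ; 0-closed = trans (lookup-𝟎 i) (sym (lookup-𝟎 k))
  ; +-closed = λ {u} {v} p q →
      trans (lookup-⊕ u v i) (trans (cong₂ _+₃_ p q) (sym (lookup-⊕ u v k)))
  ; ·-closed = λ a {v} p → trans (lookup-⊙ a v i) (trans (cong (a *₃_) p) (sym (lookup-⊙ a v k)))
  }

u∝𝟎⇒u≡𝟎 : {u : Vect n} → u ∝ 𝟎 → u ≡ 𝟎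
u∝𝟎⇒u≡𝟎 (a , refl) = ⊙𝟎 a

-- A line over GF(3) has four points.
line-points : ∀ a b (u v : Vect n) → let w = a ⊙ u ⊕ b ⊙ v in
              w ∝ u ⊎ w ∝ v ⊎ w ∝ u ⊕ v ⊎ w ∝ u ⊖ v
line-points 0F b  u v = inj₂ (inj₁ (b ,
  sym (trans (cong (_⊕ b ⊙ v) (0⊙ u)) (⊕-identityˡ (b ⊙ v)))))
line-points a  0F u v = inj₁ (a ,
  sym (trans (cong (a ⊙ u ⊕_) (0⊙ v)) (⊕-identityʳ (a ⊙ u))))
line-points 1F 1F u v = inj₂ (inj₂ (inj₁ (1F , solve (u ∷ v ∷ [])
  (1F :· (var 0F :+ var 1F)) (1F :· var 0F :+ 1F :· var 1F) refl)))
line-points 1F 2F u v = inj₂ (inj₂ (inj₂ (1F , solve (u ∷ v ∷ [])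
  (1F :· (var 0F :+ 2F :· var 1F)) (1F :· var 0F :+ 2F :· var 1F) refl)))
line-points 2F 1F u v = inj₂ (inj₂ (inj₂ (2F , solve (u ∷ v ∷ [])
  (2F :· (var 0F :+ 2F :· var 1F)) (2F :· var 0F :+ 1F :· var 1F) refl)))
line-points 2F 2F u v = inj₂ (inj₂ (inj₁ (2F , solve (u ∷ v ∷ [])
  (2F :· (var 0F :+ var 1F)) (2F :· var 0F :+ 2F :· var 1F) refl)))

abstract
  -- Different pairs of the six affine points have joins in different directions. The alternative
  -- `l ≡ m` covers the zero difference, which is proportional to everything.
  same-direction : ∀ j k l m → j ≢ k → s l ⊖ s m ∝ s j ⊖ s k → l ≡ m ⊎ l ≡ j ⊎ l ≡ k
  same-direction = toWitness
    {a? = all? λ j → all? λ k → all? λ l → all? λ m →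
      ¬? (j ≟ k) →-dec (s l ⊖ s m ∝? s j ⊖ s k →-dec (l ≟ m ⊎-dec (l ≟ j ⊎-dec l ≟ k)))} _

  third-index : ∀ (j l : Fin 6) → ∃[ k ] k ≢ j × k ≢ l
  third-index = toWitness {a? = all? λ j → all? λ l → any? λ k → ¬? (k ≟ j) ×-dec ¬? (k ≟ l)} _

  s-proportional : ∀ j k → (1F ∷ s j) ∝ (1F ∷ s k) → j ≡ k
  s-proportional = toWitness {a? = all? λ j → all? λ k → (1F ∷ s j) ∝? (1F ∷ s k) →-dec j ≟ k} _

-- These split `h` into two 0-1 vectors with disjoint supports. Their difference is `h` and their
-- sum is again a 0-1 vector, so `h` is the fourth point of a line on which the other three are 0-1
-- vectors.
positive negative : GF3 → GF3
positive 0F = 0F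
positive 1F = 1F
positive 2F = 0F
negative 0F = 0F
negative 1F = 0F
negative 2F = 1F

positive⊖negative : (h : Vect n) → map positive h ⊖ map negative h ≡ h
positive⊖negative []       = refl
positive⊖negative (0F ∷ h) = cong (0F ∷_) (positive⊖negative h)
positive⊖negative (1F ∷ h) = cong (1F ∷_) (positive⊖negative h)
positive⊖negative (2F ∷ h) = cong (2F ∷_) (positive⊖negative h)

ZeroOne : Vect n → Set
ZeroOne h = ∀ k → lookup h k ≡ 0F ⊎ lookup h k ≡ 1F

positive-01 : (h : Vect n) → ZeroOne (map positive h)
positive-01 (0F ∷ h) 0F = inj₁ refl
positive-01 (1F ∷ h) 0F = inj₂ refl
positive-01 (2F ∷ h) 0F = inj₁ refl
positive-01 (_ ∷ h) (suc k) = positive-01 h k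

negative-01 : (h : Vect n) → ZeroOne (map negative h)
negative-01 (0F ∷ h) 0F = inj₁ refl
negative-01 (1F ∷ h) 0F = inj₁ refl
negative-01 (2F ∷ h) 0F = inj₂ refl
negative-01 (_ ∷ h) (suc k) = negative-01 h k

support-01 : (h : Vect n) → ZeroOne (map positive h ⊕ map negative h)
support-01 (0F ∷ h) 0F = inj₁ refl
support-01 (1F ∷ h) 0F = inj₂ refl
support-01 (2F ∷ h) 0F = inj₂ refl
support-01 (_ ∷ h) (suc k) = support-01 h k

-- A collineation acting on coordinate vectors, without linearity: the scalars in `f-line` may
-- depend on all of `u`, `v`, `a` and `b`.
module _ (f : V → V)
         (f-line : ∀ u v a b → ∃[ γ ] ∃[ δ ] γ ⊙ f u ⊕ δ ⊙ f v ≡ f (a ⊙ u ⊕ b ⊙ v))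
         (f-reflects-∝ : ∀ u v → f u ∝ f v → u ∝ v)
         (f-𝟎 : f 𝟎 ≡ 𝟎)
         (f-vertex : ∀ i → f (0F ∷ unit i) ∝ 0F ∷ unit i)
         (f-standard : ∀ {v} → Standard v → ∃[ w ] Standard w × f v ∝ w)
  where

  Fixed : V → Set
  Fixed v = f v ∝ v

  f≡𝟎⇒≡𝟎 : ∀ u → f u ≡ 𝟎 → u ≡ 𝟎
  f≡𝟎⇒≡𝟎 u fu≡0 = u∝𝟎⇒u≡𝟎 (f-reflects-∝ u 𝟎 (0F , trans (0⊙ (f 𝟎)) (sym fu≡0)))

  fixed-𝟎 : Fixed 𝟎
  fixed-𝟎 = 0F , trans (0⊙ 𝟎) (sym f-𝟎)

  -- By injectivity: `x` and the fixed `u` have the same image, so they are the same point. This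
  -- settles every case in which an image falls on a point already known to be fixed.
  ∝-fixed : ∀ u x → Fixed u → f x ∝ u → Fixed x
  ∝-fixed u x fixed-u fx∝u with x ≟ᵥ 𝟎
  ... | yes refl = fixed-𝟎
  ... | no  x≢0  = ∝-trans fx∝u
    (f-reflects-∝ u x (∝-trans fixed-u (∝-sym (x≢0 ∘ f≡𝟎⇒≡𝟎 x) fx∝u)))

  f-line-fixed : ∀ {u v} → Fixed u → Fixed v → ∀ a b →
                 ∃[ γ ] ∃[ δ ] γ ⊙ u ⊕ δ ⊙ v ≡ f (a ⊙ u ⊕ b ⊙ v)
  f-line-fixed {u} {v} (x , xu≡fu) (y , yv≡fv) a b =
    let γ , δ , eq = f-line u v a b in
    γ *₃ x , δ *₃ y , trans
      (cong₂ _⊕_ (trans (⊙-assoc γ x u) (cong (γ ⊙_) xu≡fu))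
                 (trans (⊙-assoc δ y v) (cong (δ ⊙_) yv≡fv))) eq

  fixed-⊙ : ∀ {u} a → Fixed u → Fixed (a ⊙ u)
  fixed-⊙ {u} a fixed-u = ∝-fixed u (a ⊙ u) fixed-u
    (let γ , δ , eq = f-line-fixed fixed-u fixed-u a 0F in
     γ +₃ δ , trans (⊙-distribʳ γ δ u) (trans eq
       (cong f (trans (cong (a ⊙ u ⊕_) (0⊙ u)) (⊕-identityʳ (a ⊙ u))))))

  fourth-point : ∀ u v → Fixed u → Fixed v → Fixed (u ⊕ v) → Fixed (u ⊖ v)
  fourth-point u v fixed-u fixed-v fixed-u+v =
    let γ , δ , eq = f-line-fixed fixed-u fixed-v 1F 2F
        eq′ = trans eq (cong (λ w → f (w ⊖ v)) (1⊙ u))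
    in [_,_]′ (∝-fixed u (u ⊖ v) fixed-u)
      ([_,_]′ (∝-fixed v (u ⊖ v) fixed-v)
        ([_,_]′ (∝-fixed (u ⊕ v) (u ⊖ v) fixed-u+v) id))
      (subst (λ w → w ∝ u ⊎ w ∝ v ⊎ w ∝ u ⊕ v ⊎ w ∝ u ⊖ v) eq′ (line-points γ δ u v))

  -- Closure under addition and scaling needs only `f-line`. This is the substitute for linearity of
  -- `f`.
  preimage : Subspace → Subspace
  preimage U = record
    { vectors  = λ v → f v ∈ vectors U
    ; 0-closed = subst (_∈ vectors U) (sym f-𝟎) (Subspace.0-closed U)
    ; +-closed = λ {u} {v} fu∈U fv∈U →
        let γ , δ , eq = f-line u v 1F 1F in
        subst (_∈ vectors U) (trans eq (cong f (cong₂ _⊕_ (1⊙ u) (1⊙ v))))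
          (Subspace.+-closed U (Subspace.·-closed U γ fu∈U) (Subspace.·-closed U δ fv∈U))
    ; ·-closed = λ a {v} fv∈U →
        let γ , δ , eq = f-line v v a 0F in
        subst (_∈ vectors U)
          (trans eq (cong f (trans (cong (a ⊙ v ⊕_) (0⊙ v)) (⊕-identityʳ (a ⊙ v)))))
          (Subspace.+-closed U (Subspace.·-closed U γ fv∈U) (Subspace.·-closed U δ fv∈U))
    }

  -- Vertices are fixed, so those in `U` also lie in its preimage, and the remaining ones have
  -- coefficient zero in `h`.
  vertices⇒preimage : ∀ U h → (∀ j → lookup h j ≡ 0F ⊎ (0F ∷ unit j) ∈ vectors U) →
                      f (0F ∷ h) ∈ vectors U
  vertices⇒preimage U h vertices = subst (_∈ vectors (preimage U)) (0∷-linComb h)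
    (linComb∈-terms (preimage U) h (map (0F ∷_) (units 5)) λ j →
      subst (λ e → lookup h j ⊙ e ∈ vectors (preimage U))
        (sym (trans (Vec.lookup-map j (0F ∷_) (units 5)) (cong (0F ∷_) (lookup-units j))))
        (term j (vertices j)))
    where
    term : ∀ j → lookup h j ≡ 0F ⊎ (0F ∷ unit j) ∈ vectors U →
           lookup h j ⊙ (0F ∷ unit j) ∈ vectors (preimage U)
    term j (inj₁ hⱼ≡0) = subst (_∈ vectors (preimage U))
      (sym (trans (cong (_⊙ (0F ∷ unit j)) hⱼ≡0) (0⊙ (0F ∷ unit j)))) (Subspace.0-closed (preimage U))
    term j (inj₂ eⱼ∈U) = Subspace.·-closed (preimage U) (lookup h j)
      (subst (_∈ vectors U) (proj₂ (f-vertex j)) (Subspace.·-closed U (proj₁ (f-vertex j)) eⱼ∈U))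

  head-preserved : ∀ h → lookup (f (0F ∷ h)) 0F ≡ 0F
  head-preserved h = vertices⇒preimage (zeroAt 0F) h λ _ → inj₂ refl

  zero-preserved : ∀ h i → lookup h i ≡ 0F → lookup (f (0F ∷ h)) (suc i) ≡ 0F
  zero-preserved h i hᵢ≡0 = vertices⇒preimage (zeroAt (suc i)) h vertices
    where
    vertices : ∀ j → lookup h j ≡ 0F ⊎ lookup (unit j) i ≡ 0F
    vertices j with i ≟ j
    ... | yes refl = inj₁ hᵢ≡0
    ... | no  i≢j  = inj₂ (lookup-unit i≢j)

  head-𝟎 : ∀ v {j} → v ∝ 1F ∷ s j → lookup v 0F ≡ 0F → v ≡ 𝟎
  head-𝟎 _ {j} (a , refl) a*1≡0 =
    trans (cong (_⊙ (1F ∷ s j)) (*-cancel-0 1F a (λ ()) (trans (*-comm 1F a) a*1≡0))) (0⊙ (1F ∷ s j))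

  -- The image is a standard point in the preserved hyperplane, hence not affine; an image at a
  -- vertex is settled by injectivity.
  fixed-centre : Fixed (0F ∷ ones)
  fixed-centre with f-standard centre
  ... | _ , vertex i , f∝e = ∝-fixed (0F ∷ unit i) (0F ∷ ones) (f-vertex i) f∝e
  ... | _ , centre   , f∝ = f∝
  ... | _ , affine j , f∝q
    with () ← f≡𝟎⇒≡𝟎 (0F ∷ ones) (head-𝟎 (f (0F ∷ ones)) f∝q (head-preserved ones))

  -- Subtracting `lookup h i` times the centre clears both entries. So `h` is a combination of the
  -- centre and of vertices other than the two at `i` and `k`, and each of these has equal entries
  -- there.
  equal-preserved : ∀ h i k → lookup h i ≡ lookup h k →
                    lookup (f (0F ∷ h)) (suc i) ≡ lookup (f (0F ∷ h)) (suc k)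
  equal-preserved h i k hᵢ≡hₖ = subst (_∈ vectors (preimage U)) 0∷g⊕≡0∷h
    (Subspace.+-closed (preimage U) {0F ∷ g} {a ⊙ (0F ∷ ones)}
      (vertices⇒preimage U g vertices)
      (Subspace.·-closed (preimage U) a {0F ∷ ones}
        (subst (_∈ vectors U) (proj₂ fixed-centre)
          (Subspace.·-closed U (proj₁ fixed-centre) {0F ∷ ones}
            (trans (Vec.lookup-replicate i 1F) (sym (Vec.lookup-replicate k 1F)))))))
    where
    U = equalAt (suc i) (suc k)
    a = lookup h i

    g : Vect 5
    g = h ⊖ a ⊙ ones

    0∷g⊕≡0∷h : (0F ∷ g) ⊕ a ⊙ (0F ∷ ones) ≡ 0F ∷ h
    0∷g⊕≡0∷h = cong₂ _∷_ (cong (0F +₃_) (*-comm a 0F))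
      (solve (h ∷ a ⊙ ones ∷ []) ((var 0F :+ 2F :· var 1F) :+ var 1F) (var 0F) refl)

    lookup-g : ∀ j → lookup g j ≡ lookup h j +₃ 2F *₃ a
    lookup-g j = trans (lookup-⊕ h (2F ⊙ (a ⊙ ones)) j) (cong (lookup h j +₃_)
      (trans (lookup-⊙ 2F (a ⊙ ones) j) (cong (2F *₃_) (trans (lookup-⊙ a ones j)
        (trans (cong (a *₃_) (Vec.lookup-replicate j 1F)) (trans (*-comm a 1F) (*-identityˡ a)))))))

    a+2a≡0 : ∀ a → a +₃ 2F *₃ a ≡ 0F
    a+2a≡0 = toWitness {a? = all? λ a → a +₃ 2F *₃ a ≟ 0F} _

    vertices : ∀ j → lookup g j ≡ 0F ⊎ lookup (unit j) i ≡ lookup (unit j) k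
    vertices j with i ≟ j | k ≟ j
    ... | yes refl | _        = inj₁ (trans (lookup-g i) (a+2a≡0 a))
    ... | no _     | yes refl = inj₁ (trans (lookup-g k)
                                  (trans (cong (_+₃ 2F *₃ a) (sym hᵢ≡hₖ)) (a+2a≡0 a)))
    ... | no i≢j   | no k≢j   = inj₂ (trans (lookup-unit i≢j) (sym (lookup-unit k≢j)))

  -- The image vanishes where `h` does and is constant where `h` is 1, so it is a multiple of `h`.
  fixed-01 : ∀ h → ZeroOne h → Fixed (0F ∷ h)
  fixed-01 h h01 with any? (λ i → lookup h i ≟ 1F)
  ... | no  none       = subst (λ h → Fixed (0F ∷ h)) (sym (lookup-extensionality λ i →
    [_,_]′ (λ eq → trans eq (sym (lookup-𝟎 i))) (λ eq → contradiction (i , eq) none) (h01 i))) fixed-𝟎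
  ... | yes (i , hᵢ≡1) = a , lookup-extensionality entry
    where
    a = lookup (f (0F ∷ h)) (suc i)

    entry : ∀ k → lookup (a ⊙ (0F ∷ h)) k ≡ lookup (f (0F ∷ h)) k
    entry zero    = trans (*-comm a 0F) (sym (head-preserved h))
    entry (suc k) = trans (lookup-⊙ a h k) (cases (h01 k))
      where
      cases : lookup h k ≡ 0F ⊎ lookup h k ≡ 1F → a *₃ lookup h k ≡ lookup (f (0F ∷ h)) (suc k)
      cases (inj₁ hₖ≡0) = trans (cong (a *₃_) hₖ≡0) (trans (*-comm a 0F) (sym (zero-preserved h k hₖ≡0)))
      cases (inj₂ hₖ≡1) = trans (cong (a *₃_) hₖ≡1) (trans (*-comm a 1F) (trans (*-identityˡ a)
        (equal-preserved h i k (trans hᵢ≡1 (sym hₖ≡1)))))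

  fixed-hyperplane : ∀ h → Fixed (0F ∷ h)
  fixed-hyperplane h = subst (λ h → Fixed (0F ∷ h)) (positive⊖negative h)
    (fourth-point (0F ∷ map positive h) (0F ∷ map negative h)
      (fixed-01 (map positive h) (positive-01 h)) (fixed-01 (map negative h) (negative-01 h))
      (fixed-01 (map positive h ⊕ map negative h) (support-01 h)))

  -- A line through an affine point meets the fixed hyperplane in a fixed point, so
  -- the images of affine points u and v span a line of the same direction.
  f-affine : ∀ g h → ∃[ γ ] ∃[ δ ] γ ⊙ f (1F ∷ g) ⊕ δ ⊙ (0F ∷ h ⊖ g) ≡ f (1F ∷ h)
  f-affine g h =
    let γ , δ , eq = f-line (1F ∷ g) (0F ∷ h ⊖ g) 1F 1F
        b , eq′ = fixed-hyperplane (h ⊖ g)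
    in γ , δ *₃ b , (begin
      γ ⊙ f (1F ∷ g) ⊕ (δ *₃ b) ⊙ (0F ∷ h ⊖ g)
        ≡⟨ cong (γ ⊙ f (1F ∷ g) ⊕_) (trans (⊙-assoc δ b (0F ∷ h ⊖ g)) (cong (δ ⊙_) eq′)) ⟩
      γ ⊙ f (1F ∷ g) ⊕ δ ⊙ f (0F ∷ h ⊖ g)
        ≡⟨ eq ⟩
      f (1F ⊙ (1F ∷ g) ⊕ 1F ⊙ (0F ∷ h ⊖ g))
        ≡⟨ cong (λ z → f (1F ∷ z))
             (solve (g ∷ h ∷ []) (1F :· var 0F :+ 1F :· (var 1F :+ 2F :· var 0F)) (var 1F) refl) ⟩
      f (1F ∷ h) ∎)
    where open ≡-Reasoning

  affine-image : ∀ j → ∃[ l ] f (1F ∷ s j) ∝ 1F ∷ s l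
  affine-image j with f-standard (affine j)
  -- An affine point cannot be mapped to a vertex or the centre, but `∝-fixed` yields the conclusion
  -- directly.
  ... | _ , vertex i , f∝e = j , ∝-fixed (0F ∷ unit i) (1F ∷ s j) (f-vertex i) f∝e
  ... | _ , centre   , f∝c = j , ∝-fixed (0F ∷ ones) (1F ∷ s j) fixed-centre f∝c
  ... | _ , affine l , f∝q = l , f∝q

  f-affine≢𝟎 : ∀ h → f (1F ∷ h) ≢ 𝟎
  f-affine≢𝟎 h eq with () ← f≡𝟎⇒≡𝟎 (1F ∷ h) eq

  -- Joins keep their direction, so `same-direction` forces the image pair to be the original one;
  -- injectivity excludes `l ≡ m`.
  image-index : ∀ j k l m → j ≢ k → f (1F ∷ s j) ∝ 1F ∷ s l → f (1F ∷ s k) ∝ 1F ∷ s m →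
                l ≡ j ⊎ l ≡ k
  image-index j k l m j≢k fj∝l@(a , al≡fj) fk∝m@(b , bm≡fk) =
    [_,_]′ (λ { refl → contradiction
        (s-proportional j k (f-reflects-∝ (1F ∷ s j) (1F ∷ s k)
          (∝-trans fj∝l (∝-sym (f-affine≢𝟎 (s k)) fk∝m)))) j≢k })
      id (same-direction j k l m j≢k direction)
    where
    a≢0 : a ≢ 0F
    a≢0 = ∝-nonzero (f-affine≢𝟎 (s j)) fj∝l

    along : ∀ γ δ → γ ⊙ f (1F ∷ s k) ⊕ δ ⊙ (0F ∷ s j ⊖ s k) ≡ f (1F ∷ s j) →
            s l ⊖ s m ∝ s j ⊖ s k
    along γ δ eq = a *₃ δ , (begin
      (a *₃ δ) ⊙ (s j ⊖ s k)
        ≡⟨ ⊙-assoc a δ (s j ⊖ s k) ⟩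
      a ⊙ (δ ⊙ (s j ⊖ s k))
        ≡⟨ cong (a ⊙_) (solve (a ⊙ s m ∷ δ ⊙ (s j ⊖ s k) ∷ [])
             (var 1F) ((var 0F :+ var 1F) :+ 2F :· var 0F) refl) ⟩
      a ⊙ ((a ⊙ s m ⊕ δ ⊙ (s j ⊖ s k)) ⊖ a ⊙ s m)
        ≡⟨ cong (λ z → a ⊙ (z ⊖ a ⊙ s m)) tails ⟨
      a ⊙ (a ⊙ s l ⊖ a ⊙ s m)
        ≡⟨ trans (⊙-distribˡ a (a ⊙ s l) (2F ⊙ (a ⊙ s m)))
             (cong₂ _⊕_ (⊙-inverse a≢0 (s l))
               (trans (⊙-swap a 2F (a ⊙ s m)) (cong (2F ⊙_) (⊙-inverse a≢0 (s m))))) ⟩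
      s l ⊖ s m ∎)
      where
      open ≡-Reasoning
      ⊙-swap : ∀ a b (v : Vect n) → a ⊙ (b ⊙ v) ≡ b ⊙ (a ⊙ v)
      ⊙-swap a b v = trans (sym (⊙-assoc a b v)) (trans (cong (_⊙ v) (*-comm a b)) (⊙-assoc b a v))

      whole : a ⊙ (1F ∷ s l) ≡ γ ⊙ (b ⊙ (1F ∷ s m)) ⊕ δ ⊙ (0F ∷ s j ⊖ s k)
      whole = trans al≡fj (trans (sym eq) (cong (λ w → γ ⊙ w ⊕ δ ⊙ (0F ∷ s j ⊖ s k)) (sym bm≡fk)))

      -- The first coordinates determine the unknown scalar, so that only a multiple of the
      -- direction remains in the tails.
      heads : ∀ a b γ δ → a *₃ 1F ≡ γ *₃ (b *₃ 1F) +₃ δ *₃ 0F → γ *₃ b ≡ a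
      heads = toWitness {a? = all? λ a → all? λ b → all? λ γ → all? λ δ →
        a *₃ 1F ≟ γ *₃ (b *₃ 1F) +₃ δ *₃ 0F →-dec γ *₃ b ≟ a} _

      tails : a ⊙ s l ≡ a ⊙ s m ⊕ δ ⊙ (s j ⊖ s k)
      tails = trans (cong tail whole) (cong (_⊕ δ ⊙ (s j ⊖ s k))
        (trans (sym (⊙-assoc γ b (s m))) (cong (_⊙ s m) (heads a b γ δ (cong head whole)))))

    direction : s l ⊖ s m ∝ s j ⊖ s k
    direction = let γ , δ , eq = f-affine (s k) (s j) in along γ δ eq

  -- The image index is `j` or `k` for every `k` other than `j`; a `k` that also avoids the image
  -- index leaves only `j`.
  fixed-affine : ∀ j → Fixed (1F ∷ s j)
  fixed-affine j =
    let l , fj∝l = affine-image j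
        k , k≢j , k≢l = third-index j l
        m , fk∝m = affine-image k
    in [_,_]′ (λ l≡j → subst (λ i → f (1F ∷ s j) ∝ 1F ∷ s i) l≡j fj∝l)
         (λ l≡k → contradiction (sym l≡k) k≢l)
         (image-index j k l m (k≢j ∘ sym) fj∝l fk∝m)

  -- On the line to the affine point `s j`, that point and the point at infinity are fixed. Hence
  -- the image is the point itself or its reflection in `s j`, and the reflections in `s 0F` and
  -- `s 1F` are different.
  fixed-off-hyperplane : ∀ h → Fixed (1F ∷ h)
  fixed-off-hyperplane h = [_,_]′ id (λ f∝₀ → [_,_]′ id (λ f∝₁ → ⊥-elim (not-both f∝₀ f∝₁))
    (via 1F)) (via 0F)
    where
    via : ∀ j → Fixed (1F ∷ h) ⊎ f (1F ∷ h) ∝ (1F ∷ s j) ⊖ (0F ∷ h ⊖ s j)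
    via j =
      let γ , δ , eq = f-affine (s j) h
          c , eq′ = fixed-affine j
          q = 1F ∷ s j
          d = 0F ∷ h ⊖ s j
          f≡ = trans (cong (_⊕ δ ⊙ d) (trans (⊙-assoc γ c q) (cong (γ ⊙_) eq′))) eq
      in [_,_]′ (inj₁ ∘ ∝-fixed q (1F ∷ h) (fixed-affine j))
          ([_,_]′ (inj₁ ∘ ∝-fixed d (1F ∷ h) (fixed-hyperplane (h ⊖ s j)))
            ([_,_]′ (inj₁ ∘ subst (f (1F ∷ h) ∝_) (cong (1F ∷_)
                (solve (s j ∷ h ∷ []) (var 0F :+ (var 1F :+ 2F :· var 0F)) (var 1F) refl)))
              inj₂))
          (subst (λ w → w ∝ q ⊎ w ∝ d ⊎ w ∝ q ⊕ d ⊎ w ∝ q ⊖ d) f≡ (line-points (γ *₃ c) δ q d))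

    -- A point and its reflection have `s j` as midpoint, and `2F` is one half.
    midpoint : ∀ j → s j ≡ 2F ⊙ ((s j ⊖ (h ⊖ s j)) ⊕ h)
    midpoint j = solve (s j ∷ h ∷ []) (var 0F)
      (2F :· ((var 0F :+ 2F :· (var 1F :+ 2F :· var 0F)) :+ var 1F)) refl

    not-both : f (1F ∷ h) ∝ (1F ∷ s 0F) ⊖ (0F ∷ h ⊖ s 0F) →
                 f (1F ∷ h) ∝ (1F ∷ s 1F) ⊖ (0F ∷ h ⊖ s 1F) → ⊥
    not-both f∝₀ f∝₁ = s₀≢s₁ (trans (midpoint 0F)
        (trans (cong (λ w → 2F ⊙ (w ⊕ h)) (equal-tails (∝-trans (∝-sym (f-affine≢𝟎 h) f∝₀) f∝₁)))
               (sym (midpoint 1F))))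
      where
      s₀≢s₁ : s 0F ≢ s 1F
      s₀≢s₁ ()

      equal-tails : ∀ {g g′ : Vect 5} → (1F ∷ g) ∝ (1F ∷ g′) → g ≡ g′
      equal-tails {g′ = g′} (1F , eq) = trans (sym (cong tail eq)) (1⊙ g′)
      equal-tails (2F , ())

  all-fixed : ∀ v → Fixed v
  all-fixed (0F ∷ h) = fixed-hyperplane h
  all-fixed (1F ∷ h) = fixed-off-hyperplane h
  all-fixed (2F ∷ h) = subst Fixed (cong (2F ∷_) (⊙-inverse {a = 2F} (λ ()) h))
    (fixed-⊙ {1F ∷ 2F ⊙ h} 2F (fixed-off-hyperplane (2F ⊙ h)))

-- Collineations induced by linear maps

record Automorphism : Set where
  field
    to from     : V → V
    to-linear   : Linear to
    from-linear : Linear from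
    to-from     : ∀ v → to (from v) ≡ v
    from-to     : ∀ v → from (to v) ≡ v

  to-∝ : ∀ {u v} → u ∝ v → to u ∝ to v
  to-∝ {v = v} (a , refl) = a , sym (·-homo to-linear a v)

  to-reflects-∝ : ∀ {u v} → to u ∝ to v → u ∝ v
  to-reflects-∝ {u} {v} (a , eq) =
    a , trans (sym (from-to (a ⊙ v)))
          (trans (cong from (trans (·-homo to-linear a v) eq)) (from-to u))

  to≢𝟎 : ∀ {v} → v ≢ 𝟎 → to v ≢ 𝟎
  to≢𝟎 {v} v≢0 eq = v≢0 (trans (sym (from-to v)) (trans (cong from eq) (0-homo from-linear)))

open Automorphism using (to; from; to-linear; from-linear; to-from; from-to)

inverse : Automorphism → Automorphism
inverse A = record
  { to = from A ; from = to A ; to-linear = from-linear A ; from-linear = to-linear A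
  ; to-from = from-to A ; from-to = to-from A }

∘-linear : {f : Vect m → Vect n} {g : Vect d → Vect m} → Linear f → Linear g → Linear (f ∘ g)
∘-linear {f = f} {g} f-linear g-linear = record
  { +-homo = λ u v → trans (cong f (+-homo g-linear u v)) (+-homo f-linear (g u) (g v))
  ; ·-homo = λ a v → trans (cong f (·-homo g-linear a v)) (·-homo f-linear a (g v))
  }

compose : Automorphism → Automorphism → Automorphism
compose A B = record
  { to = to B ∘ to A ; from = from A ∘ from B
  ; to-linear = ∘-linear (to-linear B) (to-linear A)
  ; from-linear = ∘-linear (from-linear A) (from-linear B)
  ; to-from = λ v → trans (cong (to B) (to-from A (from B v))) (to-from B v)
  ; from-to = λ v → trans (cong (from A) (from-to B (to A v))) (from-to A v)
  }

abstract
  coordinates-of : (b : Vec V 6) → LinearlyIndependent b → V → V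
  coordinates-of b independent v = proj₁ (spanning b independent v)

  linComb-coordinates : ∀ b independent v → linComb (coordinates-of b independent v) b ≡ v
  linComb-coordinates b independent v = proj₂ (spanning b independent v)

linComb-automorphism : (b : Vec V 6) → LinearlyIndependent b → Automorphism
linComb-automorphism b independent = record
  { to = λ c → linComb c b
  ; from = coords
  ; to-linear = comb-linear b
  ; from-linear = record
      { +-homo = λ u v → injective (coords (u ⊕ v)) (coords u ⊕ coords v)
          (trans (to-coords (u ⊕ v)) (sym (trans (comb-⊕ (coords u) (coords v) b)
            (cong₂ _⊕_ (to-coords u) (to-coords v)))))
      ; ·-homo = λ a v → injective (coords (a ⊙ v)) (a ⊙ coords v)
          (trans (to-coords (a ⊙ v)) (sym (trans (comb-⊙ a (coords v) b) (cong (a ⊙_) (to-coords v)))))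
      }
  ; to-from = to-coords
  ; from-to = λ c → injective (coords (linComb c b)) c (to-coords (linComb c b))
  }
  where
  coords : V → V
  coords = coordinates-of b independent

  to-coords : ∀ v → linComb (coords v) b ≡ v
  to-coords = linComb-coordinates b independent

  injective : ∀ c c′ → linComb c b ≡ linComb c′ b → c ≡ c′
  injective c c′ eq = u⊖v≡𝟎⇒u≡v c c′ (independent (c ⊖ c′) (trans (comb-⊖ c c′ b)
    (trans (cong (_⊖ linComb c′ b) eq) (trans
      (solve (linComb c′ b ∷ []) (var 0F :+ 2F :· var 0F) (0F :· var 0F) refl)
      (0⊙ (linComb c′ b))))))

-- The image is described as the preimage under `from`, so membership involves no existential.
push : Automorphism → SubspaceOfDim d → SubspaceOfDim d
push A (U , b , isBasis) = AU , map (to A) b , record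
  { inside      = All.lookup⁻ λ i → subst (_∈ vectors U)
      (sym (trans (cong (from A) (Vec.lookup-map i (to A) b)) (from-to A (lookup b i))))
      (All.lookup⁺ (IsBasis.inside isBasis) i)
  ; independent = λ c eq → IsBasis.independent isBasis c (trans (sym (from-to A (linComb c b)))
      (trans (cong (from A) (trans (comb-homo (to-linear A) c b) eq)) (0-homo (from-linear A))))
  ; spanning    = λ {v} v∈AU → let c , eq = IsBasis.spanning isBasis v∈AU in
      c , trans (sym (comb-homo (to-linear A) c b)) (trans (cong (to A) eq) (to-from A v))
  }
  where
  AU : Subspace
  AU = record
    { vectors  = λ v → from A v ∈ vectors U
    ; 0-closed = subst (_∈ vectors U) (sym (0-homo (from-linear A))) (Subspace.0-closed U)
    ; +-closed = λ {u} {v} u∈ v∈ → subst (_∈ vectors U) (sym (+-homo (from-linear A) u v))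
        (Subspace.+-closed U u∈ v∈)
    ; ·-closed = λ a {v} v∈ → subst (_∈ vectors U) (sym (·-homo (from-linear A) a v))
        (Subspace.·-closed U a v∈)
    }

generator-push : ∀ A R → generator (push A R) ≡ to A (generator R)
generator-push A (_ , (_ ∷ []) , _) = refl

push-push : ∀ A (U : SubspaceOfDim d) {v} → v ∈ vectorsOf (push A (push (inverse A) U)) →
            v ∈ vectorsOf U
push-push A U {v} = subst (_∈ vectorsOf U) (to-from A v)

push-push⁻ : ∀ A (U : SubspaceOfDim d) {v} → v ∈ vectorsOf U →
             v ∈ vectorsOf (push A (push (inverse A) U))
push-push⁻ A U {v} = subst (_∈ vectorsOf U) (sym (to-from A v))

induced : Automorphism → Collineation
induced A = record
  { bijection = record
      { to        = push A
      ; cong      = λ (P⊆Q , Q⊆P) → (λ {v} → P⊆Q {from A v}) , (λ {v} → Q⊆P {from A v})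
      ; bijective =
          (λ {P} {Q} (AP⊆AQ , AQ⊆AP) →
              (λ {v} v∈P → push-push⁻¹ Q (AP⊆AQ (push-push⁻¹⁻ P v∈P)))
            , (λ {v} v∈Q → push-push⁻¹ P (AQ⊆AP (push-push⁻¹⁻ Q v∈Q))))
        , λ Q → push (inverse A) Q , λ {P} (P⊆ , ⊆P) →
              (λ {v} v∈AP → push-push A Q (P⊆ v∈AP))
            , (λ {v} v∈Q → ⊆P (push-push⁻ A Q v∈Q))
      }
  ; linesOntoLines = λ L → push A L ,
      (λ {R} (P , P⊆L , AP⊆R , R⊆AP) {v} v∈R → P⊆L (R⊆AP v∈R)) ,
      (λ {R} R⊆AL → push (inverse A) R ,
        (λ {v} Av∈R → subst (_∈ vectorsOf L) (from-to A v) (R⊆AL Av∈R)) ,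
        (λ {v} → push-push A R {v}) , (λ {v} → push-push⁻ A R {v}))
  }
  where
  push-push⁻¹ : ∀ (Q : Point) {v} → from A (to A v) ∈ vectorsOf Q → v ∈ vectorsOf Q
  push-push⁻¹ Q {v} = subst (_∈ vectorsOf Q) (from-to A v)
  push-push⁻¹⁻ : ∀ (Q : Point) {v} → v ∈ vectorsOf Q → from A (to A v) ∈ vectorsOf Q
  push-push⁻¹⁻ Q {v} = subst (_∈ vectorsOf Q) (sym (from-to A v))

-- Coordinates of an arbitrary collineation

combination-∝ : ∀ {a b : GF3} {u v : V} → u ≢ 𝟎 → v ≢ 𝟎 → ¬ (a ≡ 0F × b ≡ 0F) →
                a ⊙ u ⊕ b ⊙ v ≡ 𝟎 → u ∝ v
combination-∝ {a} {b} {u} {v} u≢0 v≢0 ab≢0 eq with a ≟ 0F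
... | no  a≢0  = (2F *₃ a) *₃ b , trans (⊙-assoc (2F *₃ a) b v) (solve-for a u (b ⊙ v) a≢0 eq)
... | yes refl = contradiction
  (trans (sym (⊙-inverse b≢0 v)) (trans (cong (b ⊙_) (drop-0⊙ u (b ⊙ v) eq)) (⊙𝟎 b))) v≢0
  where
  b≢0 : b ≢ 0F
  b≢0 b≡0 = ab≢0 (refl , b≡0)

-- Three vectors in the span of two are dependent.
third-on-line : (L : Line) → ∀ {u v w} → u ∈ vectorsOf L → v ∈ vectorsOf L → w ∈ vectorsOf L →
                u ≢ 𝟎 → v ≢ 𝟎 → ¬ (u ∝ v) → ∃[ γ ] ∃[ δ ] γ ⊙ u ⊕ δ ⊙ v ≡ w
third-on-line (_ , b , isBasis) {u} {v} {w} u∈L v∈L w∈L u≢0 v≢0 u∝̸v =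
  let cᵤ , eqᵤ = IsBasis.spanning isBasis u∈L
      cᵥ , eqᵥ = IsBasis.spanning isBasis v∈L
      cʷ , eqʷ = IsBasis.spanning isBasis w∈L
      c , c≢0 , eq = nontrivial-kernel (comb-linear (cʷ ∷ cᵤ ∷ cᵥ ∷ [])) ℕ.≤-refl
      dependency = trans (sym (cong₂ (λ x y → comb c (x ∷ y)) eqʷ (cong₂ (λ x y → x ∷ y ∷ []) eqᵤ eqᵥ)))
        (trans (sym (comb-homo (comb-linear b) c (cʷ ∷ cᵤ ∷ cᵥ ∷ [])))
          (trans (cong (λ c → comb c b) eq) (comb-𝟎 b)))
  in solution c c≢0 dependency
  where
  solution : ∀ c → c ≢ 𝟎 → comb c (w ∷ u ∷ v ∷ []) ≡ 𝟎 → ∃[ γ ] ∃[ δ ] γ ⊙ u ⊕ δ ⊙ v ≡ w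
  solution (x ∷ y ∷ z ∷ []) c≢0 eq = by-cases (x ≟ 0F)
    where
    eq′ : x ⊙ w ⊕ (y ⊙ u ⊕ z ⊙ v) ≡ 𝟎
    eq′ = trans (cong (λ t → x ⊙ w ⊕ (y ⊙ u ⊕ t)) (sym (⊕-identityʳ (z ⊙ v)))) eq

    by-cases : Dec (x ≡ 0F) → ∃[ γ ] ∃[ δ ] γ ⊙ u ⊕ δ ⊙ v ≡ w
    by-cases (yes refl) = contradiction
      (combination-∝ u≢0 v≢0 (λ (y≡0 , z≡0) → c≢0 (cong (0F ∷_) (cong₂ (λ y z → y ∷ z ∷ []) y≡0 z≡0)))
        (drop-0⊙ w (y ⊙ u ⊕ z ⊙ v) eq′))
      u∝̸v
    by-cases (no x≢0) = (2F *₃ x) *₃ y , (2F *₃ x) *₃ z , trans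
      (cong₂ _⊕_ (⊙-assoc (2F *₃ x) y u) (⊙-assoc (2F *₃ x) z v))
      (trans (sym (⊙-distribˡ (2F *₃ x) (y ⊙ u) (z ⊙ v)))
             (solve-for x w (y ⊙ u ⊕ z ⊙ v) x≢0 eq′))

-- A collineation in coordinates: f maps the coordinate vector of a point to a
-- coordinate vector of its image, and 𝟎 to 𝟎.
module InCoordinates (κ : Collineation) (B B′ : Automorphism) where

  open Collineation κ using (bijection; linesOntoLines)

  private
    generator≢ : ∀ {v} → v ≢ 𝟎 → to B v ≢ 𝟎
    generator≢ = Automorphism.to≢𝟎 B

  at : ∀ v → v ≢ 𝟎 → Point
  at v v≢0 = point (to B v) (generator≢ v≢0)

  private
    f′ : ∀ v → Dec (v ≡ 𝟎) → V
    f′ v (yes _)   = 𝟎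
    f′ v (no  v≢0) = from B′ (generator (at v v≢0 ^ κ))

  f : V → V
  f v = f′ v (v ≟ᵥ 𝟎)

  f-𝟎 : f 𝟎 ≡ 𝟎
  f-𝟎 = refl

  f-image : ∀ R v → generator R ∝ to B v → generator (R ^ κ) ∝ to B′ (f v)
  f-image R v R∝Bv = image′ (v ≟ᵥ 𝟎)
    where
    image′ : ∀ v≟0 → generator (R ^ κ) ∝ to B′ (f′ v v≟0)
    image′ (yes refl) = contradiction
      (u∝𝟎⇒u≡𝟎 (subst (generator R ∝_) (0-homo (to-linear B)) R∝Bv)) (generator≢𝟎 R)
    image′ (no v≢0) = subst (generator (R ^ κ) ∝_) (sym (to-from B′ (generator (at v v≢0 ^ κ))))
      (≈⇒∝ (R ^ κ) (at v v≢0 ^ κ)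
        (Bijection.cong bijection {R} {at v v≢0} (∝⇒≈ R (at v v≢0) R∝Bv)))

  f-at : ∀ v v≢0 → generator (at v v≢0 ^ κ) ∝ to B′ (f v)
  f-at v v≢0 = f-image (at v v≢0) v (∝-refl (to B v))

  f-at⁻ : ∀ v v≢0 → to B′ (f v) ∝ generator (at v v≢0 ^ κ)
  f-at⁻ v v≢0 = ∝-sym (generator≢𝟎 (at v v≢0 ^ κ)) (f-at v v≢0)

  f-nonzero : ∀ v → v ≢ 𝟎 → f v ≢ 𝟎
  f-nonzero v v≢0 eq = generator≢𝟎 (at v v≢0 ^ κ)
    (u∝𝟎⇒u≡𝟎 (subst (generator (at v v≢0 ^ κ) ∝_)
      (trans (cong (to B′) eq) (0-homo (to-linear B′))) (f-at v v≢0)))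

  𝟎∝ : ∀ (v : V) → 𝟎 ∝ v
  𝟎∝ v = 0F , 0⊙ v

  f-preserves-∝ : ∀ w v → w ∝ v → f w ∝ f v
  f-preserves-∝ w v w∝v = by-cases (w ≟ᵥ 𝟎)
    where
    by-cases : Dec (w ≡ 𝟎) → f w ∝ f v
    by-cases (yes refl) = 𝟎∝ (f v)
    by-cases (no w≢0) = Automorphism.to-reflects-∝ B′
      (∝-trans (f-at⁻ w w≢0) (f-image (at w w≢0) v (Automorphism.to-∝ B w∝v)))

  f-reflects-∝ : ∀ u v → f u ∝ f v → u ∝ v
  f-reflects-∝ u v fu∝fv = by-cases (u ≟ᵥ 𝟎) (v ≟ᵥ 𝟎)
    where
    by-cases : Dec (u ≡ 𝟎) → Dec (v ≡ 𝟎) → u ∝ v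
    by-cases (yes refl) _ = 𝟎∝ v
    by-cases (no u≢0) (yes refl) = contradiction (u∝𝟎⇒u≡𝟎 fu∝fv) (f-nonzero u u≢0)
    by-cases (no u≢0) (no v≢0) = Automorphism.to-reflects-∝ B
      (≈⇒∝ (at u u≢0) (at v v≢0) (Bijection.injective bijection {at u u≢0} {at v v≢0}
        (∝⇒≈ (at u u≢0 ^ κ) (at v v≢0 ^ κ)
          (∝-trans (f-at u u≢0) (∝-trans (Automorphism.to-∝ B′ fu∝fv) (f-at⁻ v v≢0))))))

  -- If one vector is a multiple of the other, so is the combination; both directions are tested
  -- because either vector may be `𝟎`. Otherwise `f u` and `f v` are independent and span the image
  -- line, which also contains the image of any nonzero combination.
  f-line : ∀ u v a b → ∃[ γ ] ∃[ δ ] γ ⊙ f u ⊕ δ ⊙ f v ≡ f (a ⊙ u ⊕ b ⊙ v)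
  f-line u v a b = by-cases (u ∝? v) (v ∝? u)
    where
    w : V
    w = a ⊙ u ⊕ b ⊙ v

    by-cases : Dec (u ∝ v) → Dec (v ∝ u) → ∃[ γ ] ∃[ δ ] γ ⊙ f u ⊕ δ ⊙ f v ≡ f w
    by-cases (yes (e , ev≡u)) _ =
      let δ , eq = f-preserves-∝ w v (a *₃ e +₃ b , trans (⊙-distribʳ (a *₃ e) b v)
            (cong (_⊕ b ⊙ v) (trans (⊙-assoc a e v) (cong (a ⊙_) ev≡u))))
      in 0F , δ , trans (cong (_⊕ δ ⊙ f v) (0⊙ (f u))) (trans (⊕-identityˡ (δ ⊙ f v)) eq)
    by-cases (no _) (yes (e , eu≡v)) =
      let γ , eq = f-preserves-∝ w u (a +₃ b *₃ e , trans (⊙-distribʳ a (b *₃ e) u)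
            (cong (a ⊙ u ⊕_) (trans (⊙-assoc b e u) (cong (b ⊙_) eu≡v))))
      in γ , 0F , trans (cong (γ ⊙ f u ⊕_) (0⊙ (f v))) (trans (⊕-identityʳ (γ ⊙ f u)) eq)
    by-cases (no u∝̸v) (no v∝̸u) = on-line (w ≟ᵥ 𝟎)
      where
      u≢0 : u ≢ 𝟎
      u≢0 u≡0 = u∝̸v (subst (_∝ v) (sym u≡0) (𝟎∝ v))
      v≢0 : v ≢ 𝟎
      v≢0 v≡0 = v∝̸u (subst (_∝ u) (sym v≡0) (𝟎∝ u))

      b-independent : LinearlyIndependent (to B u ∷ to B v ∷ [])
      b-independent (x ∷ y ∷ []) eq = both-zero (x ≟ 0F) (y ≟ 0F)
        where
        eq′ : x ⊙ to B u ⊕ y ⊙ to B v ≡ 𝟎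
        eq′ = trans (cong (x ⊙ to B u ⊕_) (sym (⊕-identityʳ (y ⊙ to B v)))) eq

        proportional : ¬ (x ≡ 0F × y ≡ 0F) → u ∝ v
        proportional xy≢0 = Automorphism.to-reflects-∝ B
          (combination-∝ (generator≢ u≢0) (generator≢ v≢0) xy≢0 eq′)

        both-zero : Dec (x ≡ 0F) → Dec (y ≡ 0F) → x ∷ y ∷ [] ≡ 𝟎
        both-zero (yes refl) (yes refl) = refl
        both-zero (no x≢0)   _          = contradiction (proportional (x≢0 ∘ proj₁)) u∝̸v
        both-zero _          (no y≢0)   = contradiction (proportional (y≢0 ∘ proj₂)) u∝̸v

      L : Line
      L = span (to B u ∷ to B v ∷ []) b-independent

      L′ : Line
      L′ = proj₁ (linesOntoLines L)

      image∈L′ : ∀ z z≢0 c → comb c (u ∷ v ∷ []) ≡ z → to B′ (f z) ∈ vectorsOf L′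
      image∈L′ z z≢0 c eq =
        let e , eq′ = f-at⁻ z z≢0 in
        subst (_∈ vectorsOf L′) eq′ (Subspace.·-closed (proj₁ L′) e
          (proj₁ (proj₂ (linesOntoLines L)) {at z z≢0 ^ κ}
            (at z z≢0 , ∝⇒⊆ (at z z≢0) L z∈L , Setoid.refl Points {at z z≢0 ^ κ})
            (generator∈ (at z z≢0 ^ κ))))
        where
        z∈L : to B z ∈ vectorsOf L
        z∈L = c , trans (sym (comb-homo (to-linear B) c (u ∷ v ∷ []))) (cong (to B) eq)

      on-line : Dec (w ≡ 𝟎) → ∃[ γ ] ∃[ δ ] γ ⊙ f u ⊕ δ ⊙ f v ≡ f w
      on-line (yes w≡0) = 0F , 0F , trans (cong₂ _⊕_ (0⊙ (f u)) (0⊙ (f v)))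
        (trans (⊕-identityˡ 𝟎) (sym (trans (cong f w≡0) f-𝟎)))
      on-line (no w≢0) =
        let γ , δ , eq = third-on-line L′
              (image∈L′ u u≢0 (unit 0F) (comb-unit 0F (u ∷ v ∷ [])))
              (image∈L′ v v≢0 (unit 1F) (comb-unit 1F (u ∷ v ∷ [])))
              (image∈L′ w w≢0 (a ∷ b ∷ []) (cong (a ⊙ u ⊕_) (⊕-identityʳ (b ⊙ v))))
              (Automorphism.to≢𝟎 B′ (f-nonzero u u≢0)) (Automorphism.to≢𝟎 B′ (f-nonzero v v≢0))
              (u∝̸v ∘ f-reflects-∝ u v ∘ Automorphism.to-reflects-∝ B′)
        in γ , δ , trans (sym (from-to B′ (γ ⊙ f u ⊕ δ ⊙ f v)))
          (trans (cong (from B′) (trans (+-homo (to-linear B′) (γ ⊙ f u) (δ ⊙ f v))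
            (trans (cong₂ _⊕_ (·-homo (to-linear B′) γ (f u)) (·-homo (to-linear B′) δ (f v))) eq)))
            (from-to B′ (f w)))

-- Existence and uniqueness of the collineation

module _ (K K′ : PointSet) (P P′ : Fin 5 → Point)
         (S : StandardForm K P) (S′ : StandardForm K′ P′) where

  private
    module S  = StandardForm S
    module S′ = StandardForm S′

    B B′ : Automorphism
    B  = linComb-automorphism S.basis  S.independent
    B′ = linComb-automorphism S′.basis S′.independent

  κ : Collineation
  κ = induced (compose (inverse B) B′)

  κ-coordinates : ∀ R v → generator R ∝ to B v → generator (R ^ κ) ∝ to B′ v
  κ-coordinates R v (a , eq) = a , trans
    (trans (sym (·-homo (to-linear B′) a v)) (cong (to B′)
      (trans (sym (from-to B (a ⊙ v))) (cong (from B) (trans (·-homo (to-linear B) a v) eq)))))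
    (sym (generator-push (compose (inverse B) B′) R))

  K^κ≐K′ : points K ^ˢ κ ≐ points K′
  K^κ≐K′ =
      (λ {R′} (R , R∈K , Rκ≈R′) →
        let v , standard , R∝Bv = S.complete R R∈K
            T , T∈K′ , T∝B′v = S′.sound standard
        in PointSet.respects K′ {T} {R′}
             (≈-trans T (R ^ κ) R′
               (∝⇒≈ T (R ^ κ) (∝-trans T∝B′v
                 (∝-sym (generator≢𝟎 (R ^ κ)) (κ-coordinates R v R∝Bv)))) Rκ≈R′) T∈K′)
    , (λ {R′} R′∈K′ →
        let v , standard , R′∝B′v = S′.complete R′ R′∈K′
            R , R∈K , R∝Bv = S.sound standard
        in R , R∈K , ∝⇒≈ (R ^ κ) R′ (∝-trans (κ-coordinates R v R∝Bv)
             (∝-sym (generator≢𝟎 R′) R′∝B′v)))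

  P^κ≈P′ : ∀ i → P i ^ κ ≈ P′ i
  P^κ≈P′ i = ∝⇒≈ (P i ^ κ) (P′ i) (∝-trans (κ-coordinates (P i) (0F ∷ unit i) (S.vertices i))
    (∝-sym (generator≢𝟎 (P′ i)) (S′.vertices i)))

  -- In the coordinates of the two standard forms `κ` is the identity, so the claim is that the
  -- coordinate map of `κ′` fixes every vector up to a scalar.
  κ-unique : ∀ κ′ → points K ^ˢ κ′ ≐ points K′ → (∀ i → P i ^ κ′ ≈ P′ i) → κ ≈ᶜ κ′
  κ-unique κ′ K^κ′≐K′ P^κ′≈P′ R = ∝⇒≈ (R ^ κ) (R ^ κ′)
    (∝-trans (κ-coordinates R v R∝Bv) (∝-sym (generator≢𝟎 (R ^ κ′))
      (∝-trans (f-image R v R∝Bv) (Automorphism.to-∝ B′ (all-fixed f f-line f-reflects-∝ f-𝟎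
        f-vertex f-standard v)))))
    where
    open InCoordinates κ′ B B′

    v : V
    v = from B (generator R)

    R∝Bv : generator R ∝ to B v
    R∝Bv = subst (generator R ∝_) (sym (to-from B (generator R))) (∝-refl (generator R))

    f∝ : ∀ v w T → generator T ∝ to B v → generator (T ^ κ′) ∝ to B′ w → f v ∝ w
    f∝ v w T T∝Bv Tκ′∝B′w = Automorphism.to-reflects-∝ B′
      (∝-trans (∝-sym (generator≢𝟎 (T ^ κ′)) (f-image T v T∝Bv)) Tκ′∝B′w)

    f-vertex : ∀ i → f (0F ∷ unit i) ∝ 0F ∷ unit i
    f-vertex i = f∝ (0F ∷ unit i) (0F ∷ unit i) (P i) (S.vertices i)
      (∝-trans (≈⇒∝ (P i ^ κ′) (P′ i) (P^κ′≈P′ i)) (S′.vertices i))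

    f-standard : ∀ {v} → Standard v → ∃[ w ] Standard w × f v ∝ w
    f-standard {v} standard =
      let T , T∈K , T∝Bv = S.sound standard
          w , standard′ , Tκ′∝B′w = S′.complete (T ^ κ′)
            (proj₁ K^κ′≐K′ {T ^ κ′} (T , T∈K , Setoid.refl Points {T ^ κ′}))
      in w , standard′ , f∝ v w T T∝Bv Tκ′∝B′w

theorem3 : (K K′ : PointSet) →
    K HasSize 12 →
    K′ HasSize 12 →
    ((H : Hyperplane) → ∃[ n ] n ∈ˡ (0 ∷ 3 ∷ 6 ∷ []) × (pointsOf H ⊓ K) HasSize n) →
    ((H : Hyperplane) → ∃[ n ] n ∈ˡ (0 ∷ 3 ∷ 6 ∷ []) × (pointsOf H ⊓ K′) HasSize n) →
    (P P′ : Fin 5 → Point) →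
    (∀ i → P i ∈ points K) → Injective _≡_ _≈_ P →
    (∀ i → P′ i ∈ points K′) → Injective _≡_ _≈_ P′ →
    ∃! _≈ᶜ_ λ κ →
    (points K ^ˢ κ) ≐ points K′ × (∀ i → P i ^ κ ≈ P′ i)
theorem3 K K′ size size′ sections sections′ P P′ P∈K P-injective P′∈K′ P′-injective =
    κ K K′ P P′ S S′
  , (K^κ≐K′ K K′ P P′ S S′ , P^κ≈P′ K K′ P P′ S S′)
  , λ {κ′} (K^κ′≐K′ , P^κ′≈P′) → κ-unique K K′ P P′ S S′ κ′ K^κ′≐K′ P^κ′≈P′
  where
  S : StandardForm K P
  S = standardForm K sections size P P-injective P∈K

  S′ : StandardForm K′ P′
  S′ = standardForm K′ sections′ size′ P′ P′-injective P′∈K′
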